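{- Let $T$ be a complete first-order theory in a language $\mathcal L$, and suppose the $\mathcal L$-formula $\phi(x,y)$ is NIP. Then there is an $\mathcal L$-formula $\psi(x,z)$ such that whenever $M\vDash T$, $D\subseteq M^x$ has size $>1$ and $p\in S_{\phi^{\mathrm{opp}}}(D)$ is pseudofinite, $p$ is definable by an instance of $\psi$ over $D^z$; that is, there is $e\in D^z$ such that for all $a\in D$: $\phi(a,y)\in p$ if and only if $M\vDash\psi(a,e)$. Moreover, if $T$ has Skolem functions, then $\psi(x,z)$ can be chosen to be NIP.
   Context: A formula $\phi(x,y)$ is NIP (in $T$) if for some (equivalently every) $M\vDash T$ the family $\{\phi(M^x,b):b\in M^y\}$ has finite VC-dimension. $z$ is a tuple of variables each of the sort of $x$, so that $D^z$ is the set of corresponding tuples of elements of $D$. For $D\subseteq M^x$, $S_{\phi^{\mathrm{opp}}}(D)$ is the set of maximal consistent (with the elementary diagram of $M$) sets of formulas $\phi(a,y)$, $\neg\phi(a,y)$ with $a\in D$. Write $\phi^1=\phi$, $\phi^0=\neg\phi$. Pseudofinite types: let $\mathcal L'=\mathcal L\cup\{P,Q\}$ where $P,Q$ are new predicates for subsets of the sort of $x$. For $p\in S_{\phi^{\mathrm{opp}}}(D)$ and $\epsilon<2$ let $D^\epsilon=\{a\in D:\phi(a,y)^\epsilon\in p\}$. Then $p$ is pseudofinite if for every $\mathcal L'$-sentence $\varphi$, if $(M,D^0,D^1)\vDash\varphi$ (with $P,Q$ interpreted as $D^0,D^1$) then there is an $\mathcal L'$-structure $N$ such that $N\vDash\varphi$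 and $P^N,Q^N$ are finite. $T$ has Skolem functions if for every $\mathcal L$-formula $\theta(u,y)$ there is a $\emptyset$-definable function $f$ such that $T\vdash\forall u(\exists y\,\theta(u,y)\rightarrow\theta(u,f(u)))$. -}

module Defs where

open import Level using (Level; _⊔_; Lift) renaming (suc to lsuc)
open import Data.Bool.Base using (Bool; true; false)
open import Data.Empty using (⊥)
open import Data.Fin.Base using (Fin)
open import Data.Fin.Subset using (Subset) renaming (_∈_ to _∈ˢ_)
open import Data.List.Base using (List; []; _∷_; _++_)
open import Data.List.Membership.Propositional using (_∈_)
open import Data.List.Relation.Unary.All as All using (All; []; _∷_)
open import Data.List.Relation.Unary.All.Properties using (++⁺)
open import Data.Nat.Base using (ℕ; zero; suc; _≤_)
open import Data.Product.Base using (Σ; ∃; _×_; _,_; proj₁)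
open import Data.Product using (∃!)
open import Data.Sum.Base using (_⊎_)
open import Data.Vec.Base using (Vec; []; _∷_)
open import Data.Vec.Relation.Unary.All using () renaming (All to Allᵛ)
open import Function.Bundles using (_⇔_)
open import Function.Definitions using (Injective)
open import Relation.Binary.PropositionalEquality using (_≡_; _≢_)
open import Relation.Unary using (Pred; _⊆_) renaming (_∈_ to _∈ᴾ_)

record Language (ℓ : Level) : Set (lsuc ℓ) where
  field
    Sort : Set ℓ
    Fun  : List Sort → Sort → Set ℓ
    Rel  : List Sort → Set ℓ

-- A context lists the sorts of a tuple of variables.
Ctx : ∀ {ℓ} → Language ℓ → Set ℓ
Ctx L = List (Language.Sort L)

module _ {ℓ : Level} (L : Language ℓ) where
  open Language L

  data Term (Γ : Ctx L) : Sort → Set ℓ where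
    var : ∀ {s} → s ∈ Γ → Term Γ s
    app : ∀ {ss s} → Fun ss s → All (Term Γ) ss → Term Γ s

  -- Variables are de Bruijn indices; a quantifier binds the head of the context.
  data Formula : Ctx L → Set ℓ where
    ⊥ᶠ          : ∀ {Γ} → Formula Γ
    _≈ᶠ_        : ∀ {Γ s} → Term Γ s → Term Γ s → Formula Γ
    rel         : ∀ {Γ ss} → Rel ss → All (Term Γ) ss → Formula Γ
    _∧ᶠ_ _∨ᶠ_ _⇒ᶠ_ : ∀ {Γ} → Formula Γ → Formula Γ → Formula Γ
    ∀ᶠ ∃ᶠ       : ∀ {Γ} s → Formula (s ∷ Γ) → Formula Γ

  Sentence : Set ℓ
  Sentence = Formula []

  Theory : Set (lsuc ℓ)
  Theory = Pred Sentence ℓ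

  record Structure : Set (lsuc ℓ) where
    field
      Carrier  : Sort → Set ℓ
      nonempty : ∀ s → Carrier s
      ⟦_⟧ᶠ     : ∀ {ss s} → Fun ss s → All Carrier ss → Carrier s
      ⟦_⟧ʳ     : ∀ {ss} → Rel ss → Pred (All Carrier ss) ℓ

module _ {ℓ : Level} {L : Language ℓ} where
  open Language L
  open Structure

  infixl 30 _^ᶠ_
  _^ᶠ_ : ∀ {Γ} → Formula L Γ → Bool → Formula L Γ
  φ ^ᶠ true  = φ
  φ ^ᶠ false = φ ⇒ᶠ ⊥ᶠ

  -- M ^ x is the set of tuples from M of the sorts listed in x.
  infixl 8 _^_
  _^_ : Structure L → Ctx L → Set ℓ
  M ^ x = All (Carrier M) x

  mutual
    evalᵗ : ∀ (M : Structure L) {Γ s} → M ^ Γ → Term L Γ s → Carrier M s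
    evalᵗ M v (var i)    = All.lookup v i
    evalᵗ M v (app f ts) = ⟦ M ⟧ᶠ f (evalᵗˢ M v ts)

    evalᵗˢ : ∀ (M : Structure L) {Γ ss} → M ^ Γ → All (Term L Γ) ss → M ^ ss
    evalᵗˢ M v []       = []
    evalᵗˢ M v (t ∷ ts) = evalᵗ M v t ∷ evalᵗˢ M v ts

  infix 4 _⊨_[_] _⊨_ _⊨ᵀ_
  _⊨_[_] : ∀ (M : Structure L) {Γ} → Formula L Γ → M ^ Γ → Set ℓ
  M ⊨ ⊥ᶠ       [ v ] = Lift ℓ ⊥
  M ⊨ t ≈ᶠ u   [ v ] = evalᵗ M v t ≡ evalᵗ M v u
  M ⊨ rel R ts [ v ] = ⟦ M ⟧ʳ R (evalᵗˢ M v ts)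
  M ⊨ φ ∧ᶠ χ   [ v ] = M ⊨ φ [ v ] × M ⊨ χ [ v ]
  M ⊨ φ ∨ᶠ χ   [ v ] = M ⊨ φ [ v ] ⊎ M ⊨ χ [ v ]
  M ⊨ φ ⇒ᶠ χ   [ v ] = M ⊨ φ [ v ] → M ⊨ χ [ v ]
  M ⊨ ∀ᶠ s φ   [ v ] = ∀ (m : Carrier M s) → M ⊨ φ [ m ∷ v ]
  M ⊨ ∃ᶠ s φ   [ v ] = Σ (Carrier M s) λ m → M ⊨ φ [ m ∷ v ]

  _⊨_ : Structure L → Sentence L → Set ℓ
  M ⊨ σ = M ⊨ σ [ [] ]

  _⊨ᵀ_ : Structure L → Theory L → Set ℓ
  M ⊨ᵀ T = ∀ {σ} → σ ∈ᴾ T → M ⊨ σ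

  -- Semantic consequence, over structures in the same universe as L.
  infix 4 _⊢_
  _⊢_ : Theory L → Sentence L → Set (lsuc ℓ)
  T ⊢ σ = ∀ M → M ⊨ᵀ T → M ⊨ σ

  Satisfiable : Theory L → Set (lsuc ℓ)
  Satisfiable T = ∃ λ M → M ⊨ᵀ T

  Complete : Theory L → Set (lsuc ℓ)
  Complete T = Satisfiable T × (∀ σ → T ⊢ σ ⊎ T ⊢ σ ^ᶠ false)

Finite : ∀ {a ℓ} {A : Set a} → Pred A ℓ → Set (a ⊔ ℓ)
Finite S = ∃ λ xs → ∀ {a} → a ∈ᴾ S → a ∈ xs

Nontrivial : ∀ {a ℓ} {A : Set a} → Pred A ℓ → Set (a ⊔ ℓ)
Nontrivial D = ∃ λ a → ∃ λ b → a ∈ᴾ D × b ∈ᴾ D × a ≢ b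

-- The family {F i : i ∈ I} cuts out every subset of {a₀, …, aₙ₋₁}.
Shatters : ∀ {i x ℓ} {I : Set i} {X : Set x} → (I → Pred X ℓ) →
           ∀ {n} → (Fin n → X) → Set (i ⊔ ℓ)
Shatters F {n} a = ∀ (S : Subset n) → ∃ λ i → ∀ k → (a k ∈ᴾ F i ⇔ k ∈ˢ S)

FiniteVC : ∀ {i x ℓ} {I : Set i} {X : Set x} → (I → Pred X ℓ) → Set (i ⊔ x ⊔ ℓ)
FiniteVC {X = X} F = ∃ λ d → ∀ {n} (a : Fin n → X) → Injective _≡_ _≡_ a →
                             Shatters F a → n ≤ d

module _ {ℓ : Level} {L : Language ℓ} where

  -- The partition of the free variables is explicit, since it cannot be
  -- recovered from the concatenation.
  NIP : Theory L → (x y : Ctx L) → Formula L (x ++ y) → Set (lsuc ℓ)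
  NIP T x y φ = ∃ λ M → M ⊨ᵀ T ×
    FiniteVC (λ (b : M ^ y) (a : M ^ x) → M ⊨ φ [ ++⁺ a b ])

  -- A model of the elementary diagram of M.
  record ElementaryExtension (M : Structure L) : Set (lsuc ℓ) where
    open Structure
    field
      target     : Structure L
      embed      : ∀ {s} → Carrier M s → Carrier target s
      elementary : ∀ {Γ} (χ : Formula L Γ) (v : M ^ Γ) →
                   M ⊨ χ [ v ] ⇔ target ⊨ χ [ All.map embed v ]

  -- A set of formulas φ(a,y)^ε is given by the set of its index pairs (a,ε):
  -- p true a says φ(a,y) ∈ p, and p false a says ¬φ(a,y) ∈ p.
  SignedSet : Structure L → Ctx L → Set (lsuc ℓ)
  SignedSet M x = Bool → Pred (M ^ x) ℓ

  module _ (M : Structure L) (x y : Ctx L) (φ : Formula L (x ++ y)) where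

    -- The elementary diagram of M together with p has a model, the
    -- variables y being interpreted by b.
    Consistent : SignedSet M x → Set (lsuc ℓ)
    Consistent p = Σ (ElementaryExtension M) λ N →
      let open ElementaryExtension N in
      Σ (target ^ y) λ b → ∀ {ε a} → a ∈ᴾ p ε →
        target ⊨ φ ^ᶠ ε [ ++⁺ (All.map embed a) b ]

    -- p ∈ S_φᵒᵖᵖ(D)
    record IsType (D : Pred (M ^ x) ℓ) (p : SignedSet M x) : Set (lsuc ℓ) where
      field
        over       : ∀ {ε} → p ε ⊆ D
        consistent : Consistent p
        maximal    : ∀ (q : SignedSet M x) → (∀ {ε} → q ε ⊆ D) → Consistent q →
                     (∀ {ε} → p ε ⊆ q ε) → ∀ {ε} → q ε ⊆ p ε

module _ {ℓ : Level} (L : Language ℓ) (x : Ctx L) where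
  open Language L

  data RelPQ : Ctx L → Set ℓ where
    old : ∀ {ss} → Rel ss → RelPQ ss
    P Q : RelPQ x

  LanguagePQ : Language ℓ
  LanguagePQ = record { Sort = Sort ; Fun = Fun ; Rel = RelPQ }

module _ {ℓ : Level} {L : Language ℓ} {x : Ctx L} where
  open Structure

  expand : (M : Structure L) → (A B : Pred (M ^ x) ℓ) → Structure (LanguagePQ L x)
  expand M A B = record
    { Carrier  = Carrier M
    ; nonempty = nonempty M
    ; ⟦_⟧ᶠ     = ⟦ M ⟧ᶠ
    ; ⟦_⟧ʳ     = λ { (old R) → ⟦ M ⟧ʳ R ; P → A ; Q → B }
    }

  -- For a type p over D, the sets D⁰ and D¹ are p false and p true.
  Pseudofinite : (M : Structure L) → SignedSet M x → Set (lsuc ℓ)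
  Pseudofinite M p = ∀ (σ : Sentence (LanguagePQ L x)) →
    expand M (p false) (p true) ⊨ σ →
    Σ (Structure (LanguagePQ L x)) λ N →
      N ⊨ σ × Finite (⟦ N ⟧ʳ P) × Finite (⟦ N ⟧ʳ Q)

module _ {ℓ : Level} {L : Language ℓ} where

  record DefinableFunction (T : Theory L) (u y : Ctx L) : Set (lsuc ℓ) where
    field
      graph      : Formula L (u ++ y)
      functional : ∀ M → M ⊨ᵀ T → ∀ (a : M ^ u) →
                   ∃! _≡_ λ (b : M ^ y) → M ⊨ graph [ ++⁺ a b ]

    apply : ∀ M → M ⊨ᵀ T → M ^ u → M ^ y
    apply M M⊨T a = proj₁ (functional M M⊨T a)

  HasSkolemFunctions : Theory L → Set (lsuc ℓ)
  HasSkolemFunctions T = ∀ (u y : Ctx L) (θ : Formula L (u ++ y)) →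
    Σ (DefinableFunction T u y) λ f →
      ∀ M (M⊨T : M ⊨ᵀ T) (a : M ^ u) →
      (Σ (M ^ y) λ b → M ⊨ θ [ ++⁺ a b ]) →
      M ⊨ θ [ ++⁺ a (DefinableFunction.apply f M M⊨T a) ]

  -- The context of an n-tuple z of variables each of the sort of x.
  copies : ℕ → Ctx L → Ctx L
  copies zero    x = []
  copies (suc n) x = x ++ copies n x

  tuple : ∀ (M : Structure L) {x n} → Vec (M ^ x) n → M ^ copies n x
  tuple M []      = []
  tuple M (a ∷ e) = ++⁺ a (tuple M e)

  DefinesPseudofiniteTypes : Theory L → (x y : Ctx L) → Formula L (x ++ y) →
                             (n : ℕ) → Formula L (x ++ copies n x) → Set (lsuc ℓ)
  DefinesPseudofiniteTypes T x y φ n ψ =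
    ∀ (M : Structure L) → M ⊨ᵀ T →
    ∀ (D : Pred (M ^ x) ℓ) → Nontrivial D →
    ∀ (p : SignedSet M x) → IsType M x y φ D p → Pseudofinite M p →
    Σ (Vec (M ^ x) n) λ e → Allᵛ D e ×
      (∀ a → a ∈ᴾ D → (a ∈ᴾ p true ⇔ M ⊨ ψ [ ++⁺ a (tuple M e) ]))

{-# OPTIONS --safe #-}

-- Since the truth of a sentence has to be transferred to a structure N with P and Q finite, p is only
-- known there to be realised on samples of bounded size, and φ to have bounded VC-dimension.  By the
-- ε-net theorem, every weighting of the finite domain D admits a bounded sample such that each b
-- agreeing with p on it has small weighted error.  A further bounded sample (a teaching set, whose size
-- is bounded in terms of the VC-dimension) determines φ(a,b), for a in D, for one such b; with Skolem
-- functions, b is instead chosen as a function of the sample.  Boosting gives a sequence of such b that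
-- mostly agree with p at each a in D, and the ε-net theorem for the dual class extracts from it boundedly
-- many b whose values φ(a,b) determine whether φ(a,y) is in p.  The resulting Boolean combination is
-- written as a decision tree; the labels on the samples and the leaves are coded by equalities between
-- parameters, which is where D having two elements is used.

module Submission where

open import Level using (Level; Lift; lift) renaming (suc to lsuc)
open import Axiom.ExcludedMiddle using (ExcludedMiddle)
open import Data.Bool.Base using (Bool; true; false; not; _xor_; if_then_else_)
open import Data.Bool.Properties using (xor-same; ¬-not; not-¬) renaming (_≟_ to _≟ᵇ_)
open import Data.Empty using (⊥; ⊥-elim)
open import Data.Fin.Base using (Fin; zero; suc; _↑ˡ_)
open import Data.Fin.Properties using () renaming (_≟_ to _≟ᶠ_)
open import Data.Fin.Subset using () renaming (_∈_ to _∈ˢ_)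
open import Data.List.Base as List using (List; []; _∷_; _++_; length; filter; cartesianProductWith)
open import Data.List.Membership.Propositional using (_∈_; lose)
open import Data.List.Membership.Propositional.Properties
  using (∈-++⁺ˡ; ∈-++⁺ʳ; ∈-map⁺; ∈-filter⁺; ∈-cartesianProductWith⁺; ∈-allFin)
open import Data.List.Properties using (length-++; length-map; length-tabulate; filter-notAll)
open import Data.List.Relation.Unary.All as All using (All; []; _∷_)
open import Data.List.Relation.Unary.All.Properties as All using (++⁺; ++⁻ˡ; ++⁻ʳ)
open import Data.List.Relation.Unary.Any as Any using (here; there)
open import Data.List.Relation.Unary.Any.Properties using (lookup-index)
open import Data.Nat.Base renaming (_^_ to _^ℕ_)
open import Data.Nat.ListAction using (sum)
open import Data.Nat.Properties
open import Data.Nat.Tactic.RingSolver using (solve-∀)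
open import Data.Product.Base using (Σ; ∃; _×_; _,_; proj₁; proj₂)
open import Data.Sum.Base using (_⊎_; inj₁; inj₂; [_,_]′)
open import Data.Vec.Base as Vec using (Vec; []; _∷_)
import Data.Vec.Properties as Vec
open import Data.Vec.Relation.Unary.All as Allᵛ using ([]; _∷_) renaming (All to Allᵛ)
import Data.Vec.Relation.Unary.All.Properties as Allᵛ
open import Function.Base using (_∘_; id; flip; case_of_)
open import Function.Bundles using (_⇔_; mk⇔; Equivalence)
open import Function.Definitions using (Injective)
open import Relation.Binary.PropositionalEquality hiding ([_])
open import Relation.Nullary using (¬_; yes; no; does)
open import Relation.Nullary.Decidable using (decidable-stable; dec-true; dec-false)
open import Relation.Unary using (Pred)
open import Defs

open Equivalence using (to; from)

-- Parameters must lie in D, whereas a hypothesis b is a tuple of the sorts of y, so b has to be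
-- named by a formula over D. Agreement with p on a sample leaves many b, and asking whether some of
-- them satisfies φ(a,b) would have no controlled answer. A teaching set repairs this at the
-- parameters that the construction supplies; at other parameters the test is a union of instances
-- of φ, over whose VC-dimension there is no control. A Skolem function makes the test an instance
-- of φ at every parameter, which is what makes ψ NIP. The Boolean function from the values φ(a,b)
-- to p depends on p, while ψ may not; so its truth table is stored in the parameters too.
-- Finiteness of the domain enters twice: boosting weighs its n points against the number of rounds,
-- and the search for a teaching set ends because there are finitely many patterns. Constants: with
-- error 1/31 and weights 32 ^ errors, a round at most doubles the total weight; after 4n rounds
-- 2^(4n) * n < 32^n, so each point has fewer than n errors, and points with different labels are
-- separated by more than half of the hypotheses, enough for a net with K = 3.

-- Polynomial against exponential growth

n<2^n : ∀ n → n < 2 ^ℕ n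
n<2^n zero    = s≤s z≤n
n<2^n (suc n) = begin
  1 + suc n       ≤⟨ +-mono-≤ (m^n>0 2 n) (n<2^n n) ⟩
  2 ^ℕ n + 2 ^ℕ n   ≡⟨ cong (2 ^ℕ n +_) (+-identityʳ _) ⟨
  2 ^ℕ suc n       ∎
  where open ≤-Reasoning

bernoulli : ∀ s m → s ^ℕ suc m + suc m * s ^ℕ m ≤ suc s ^ℕ suc m
bernoulli s zero    = ≤-reflexive (lemma s)
  where
  lemma : ∀ s → s * 1 + 1 * 1 ≡ suc s * 1
  lemma = solve-∀
bernoulli s (suc m) = begin
  s * (s * x) + suc (suc m) * (s * x)         ≤⟨ m≤m+n _ (suc m * x) ⟩
  s * (s * x) + suc (suc m) * (s * x) + suc m * x ≡⟨ lemma s m x ⟩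
  suc s * (s * x + suc m * x)                 ≤⟨ *-monoʳ-≤ (suc s) (bernoulli s m) ⟩
  suc s * (suc s ^ℕ suc m)                     ∎
  where
  open ≤-Reasoning
  x = s ^ℕ m
  lemma : ∀ s m x → s * (s * x) + suc (suc m) * (s * x) + suc m * x ≡ suc s * (s * x + suc m * x)
  lemma = solve-∀

-- Bernoulli's inequality gives (1 + 1/s) ^ (s + 1) ≥ 2, which turns powers of a base close to 1
-- into powers of 2.
doubling : ∀ s → 2 * s ^ℕ suc s ≤ suc s ^ℕ suc s
doubling s = begin
  2 * (s * x)            ≤⟨ m≤m+n _ x ⟩
  2 * (s * x) + x        ≡⟨ lemma s x ⟩
  s * x + suc s * x      ≤⟨ bernoulli s s ⟩
  suc s ^ℕ suc s          ∎
  where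
  open ≤-Reasoning
  x = s ^ℕ s
  lemma : ∀ s x → 2 * (s * x) + x ≡ s * x + suc s * x
  lemma = solve-∀

-- Take j = 2i with i = c + 2q: then 2 ^ j is at least (i + 1)(c + 2q + 1), whose expansion contains
-- both c and 2i * q.
linear<exponential : ∀ c q → ∃ λ j → c + j * q ≤ 2 ^ℕ j
linear<exponential c q = i + i , (begin
  c + (i + i) * q                                     ≤⟨ m≤m+n _ _ ⟩
  c + (i + i) * q + (i * c + 2 * q + suc i)           ≡⟨ lemma c q i ⟩
  suc i * suc (c + 2 * q)                             ≤⟨ *-mono-≤ (n<2^n i) (n<2^n i) ⟩
  2 ^ℕ i * 2 ^ℕ i                                       ≡⟨ ^-distribˡ-+-* 2 i i ⟨
  2 ^ℕ (i + i)                                         ∎)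
  where
  open ≤-Reasoning
  i = c + 2 * q
  lemma : ∀ c q i → c + (i + i) * q + (i * c + 2 * q + suc i) ≡ suc i * suc (c + 2 * q)
  lemma = solve-∀

*-^-distrib : ∀ a b k → (a * b) ^ℕ k ≡ a ^ℕ k * b ^ℕ k
*-^-distrib a b zero    = refl
*-^-distrib a b (suc k) = trans (cong (a * b *_) (*-^-distrib a b k)) (lemma a b (a ^ℕ k) (b ^ℕ k))
  where
  lemma : ∀ a b x y → a * b * (x * y) ≡ a * x * (b * y)
  lemma = solve-∀

-- Since m = (s + 2) * 2 ^ j, `doubling` makes ((s + 2)/(s + 1)) ^ m at least 2 ^ (2 ^ j), while the
-- polynomial factor is below a power of 2 whose exponent is linear in j; `large` compares the
-- exponents.
polynomial<exponential-at : ∀ c q s j → c + suc (suc s) * q + j * q ≤ 2 ^ℕ j →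
  let m = suc (suc s) * 2 ^ℕ j in c * suc m ^ℕ q * suc s ^ℕ m < suc (suc s) ^ℕ m
polynomial<exponential-at c q s j large = begin-strict
  c * suc (b * k) ^ℕ q * suc s ^ℕ (b * k)       ≡⟨ cong (c * suc (b * k) ^ℕ q *_) (^-*-assoc (suc s) b k) ⟨
  c * suc (b * k) ^ℕ q * (suc s ^ℕ b) ^ℕ k       <⟨ *-monoˡ-< ((suc s ^ℕ b) ^ℕ k) poly<2^k ⟩
  2 ^ℕ k * (suc s ^ℕ b) ^ℕ k                     ≡⟨ *-^-distrib 2 (suc s ^ℕ b) k ⟨
  (2 * suc s ^ℕ b) ^ℕ k                         ≤⟨ ^-monoˡ-≤ k (doubling (suc s)) ⟩
  (suc (suc s) ^ℕ b) ^ℕ k                       ≡⟨ ^-*-assoc (suc (suc s)) b k ⟩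
  suc (suc s) ^ℕ (b * k)                       ∎
  where
  open ≤-Reasoning
  b = suc (suc s)
  k = 2 ^ℕ j
  instance
    nz : NonZero ((suc s ^ℕ b) ^ℕ k)
    nz = m^n≢0 (suc s ^ℕ b) k {{m^n≢0 (suc s) b}}
  suc-bk : suc (b * k) ≤ 2 ^ℕ (b + j)
  suc-bk = begin
    1 + b * k      ≤⟨ +-monoˡ-≤ (b * k) (m^n>0 2 j) ⟩
    suc b * k      ≤⟨ *-monoˡ-≤ k (n<2^n b) ⟩
    2 ^ℕ b * 2 ^ℕ j  ≡⟨ ^-distribˡ-+-* 2 b j ⟨
    2 ^ℕ (b + j)    ∎
  lemma : ∀ c b j q → c + (b + j) * q ≡ (c + b * q) + j * q
  lemma = solve-∀
  instance
    nz′ : NonZero (2 ^ℕ ((b + j) * q))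
    nz′ = m^n≢0 2 ((b + j) * q)
  poly<2^k : c * suc (b * k) ^ℕ q < 2 ^ℕ k
  poly<2^k = begin-strict
    c * suc (b * k) ^ℕ q         ≤⟨ *-monoʳ-≤ c (^-monoˡ-≤ q suc-bk) ⟩
    c * (2 ^ℕ (b + j)) ^ℕ q       ≡⟨ cong (c *_) (^-*-assoc 2 (b + j) q) ⟩
    c * 2 ^ℕ ((b + j) * q)       <⟨ *-monoˡ-< (2 ^ℕ ((b + j) * q)) (n<2^n c) ⟩
    2 ^ℕ c * 2 ^ℕ ((b + j) * q)   ≡⟨ ^-distribˡ-+-* 2 c ((b + j) * q) ⟨
    2 ^ℕ (c + (b + j) * q)       ≡⟨ cong (2 ^ℕ_) (lemma c b j q) ⟩
    2 ^ℕ (c + b * q + j * q)     ≤⟨ ^-monoʳ-≤ 2 large ⟩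
    2 ^ℕ 2 ^ℕ j                   ∎

abstract
  -- With K = s + 1 this is the hypothesis `small` of `ε-net` for a trace bound polynomial in m;
  -- with s = 0 it compares such a bound with the number 2 ^ m of all patterns.
  polynomial<exponential : ∀ c q s → ∃ λ m → c * suc m ^ℕ q * suc s ^ℕ m < suc (suc s) ^ℕ m
  polynomial<exponential c q s =
    let j , large = linear<exponential (c + suc (suc s) * q) q in _ , polynomial<exponential-at c q s j large

private variable
  a b c d x : Level
  A : Set a
  B : Set b
  C : Set c
  X : Set x

-- Sums and counting

∑ : List A → (A → ℕ) → ℕ
∑ xs f = sum (List.map f xs)

∑-mono : (xs : List A) {f g : A → ℕ} → (∀ x → f x ≤ g x) → ∑ xs f ≤ ∑ xs g
∑-mono []       f≤g = z≤n
∑-mono (x ∷ xs) f≤g = +-mono-≤ (f≤g x) (∑-mono xs f≤g)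

∑-cong : (xs : List A) {f g : A → ℕ} → (∀ x → f x ≡ g x) → ∑ xs f ≡ ∑ xs g
∑-cong []       f≡g = refl
∑-cong (x ∷ xs) f≡g = cong₂ _+_ (f≡g x) (∑-cong xs f≡g)

∑-+ : (xs : List A) (f g : A → ℕ) → ∑ xs (λ x → f x + g x) ≡ ∑ xs f + ∑ xs g
∑-+ []       f g = refl
∑-+ (x ∷ xs) f g = trans (cong (f x + g x +_) (∑-+ xs f g)) (lemma (f x) (g x) _ _)
  where
  lemma : ∀ a b c d → a + b + (c + d) ≡ a + c + (b + d)
  lemma = solve-∀

∑-* : (k : ℕ) (xs : List A) (f : A → ℕ) → ∑ xs (λ x → k * f x) ≡ k * ∑ xs f
∑-* k []       f = sym (*-zeroʳ k)
∑-* k (x ∷ xs) f = trans (cong (k * f x +_) (∑-* k xs f)) (sym (*-distribˡ-+ k (f x) _))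

∑-const : (xs : List A) (k : ℕ) → ∑ xs (λ _ → k) ≡ length xs * k
∑-const []       k = refl
∑-const (x ∷ xs) k = cong (k +_) (∑-const xs k)

∑-1 : (xs : List A) → ∑ xs (λ _ → 1) ≡ length xs
∑-1 xs = trans (∑-const xs 1) (*-identityʳ _)

∑-swap : (xs : List A) (ys : List B) (f : A → B → ℕ) →
         ∑ xs (λ x → ∑ ys (f x)) ≡ ∑ ys (λ y → ∑ xs (λ x → f x y))
∑-swap []       ys f = sym (trans (∑-const ys 0) (*-zeroʳ (length ys)))
∑-swap (x ∷ xs) ys f = trans (cong (∑ ys (f x) +_) (∑-swap xs ys f)) (sym (∑-+ ys (f x) _))

∑-++ : (xs ys : List A) (f : A → ℕ) → ∑ (xs ++ ys) f ≡ ∑ xs f + ∑ ys f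
∑-++ []       ys f = refl
∑-++ (x ∷ xs) ys f = trans (cong (f x +_) (∑-++ xs ys f)) (sym (+-assoc (f x) _ _))

∑-map : (h : A → B) (xs : List A) (f : B → ℕ) → ∑ (List.map h xs) f ≡ ∑ xs (f ∘ h)
∑-map h []       f = refl
∑-map h (x ∷ xs) f = cong (f (h x) +_) (∑-map h xs f)

term≤∑ : {xs : List A} {x : A} (f : A → ℕ) → x ∈ xs → f x ≤ ∑ xs f
term≤∑ f (here refl) = m≤m+n _ _
term≤∑ f (there x∈)  = ≤-trans (term≤∑ f x∈) (m≤n+m _ _)

-- Multiplicities replace weights, so that the ε-net theorem for lists covers weighted points.
repeat : (A → ℕ) → List A → List A
repeat w []       = []
repeat w (x ∷ xs) = List.replicate (w x) x ++ repeat w xs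

∑-replicate : (k : ℕ) (x : A) (f : A → ℕ) → ∑ (List.replicate k x) f ≡ k * f x
∑-replicate zero    x f = refl
∑-replicate (suc k) x f = cong (f x +_) (∑-replicate k x f)

∑-repeat : (w : A → ℕ) (xs : List A) (f : A → ℕ) → ∑ (repeat w xs) f ≡ ∑ xs (λ x → w x * f x)
∑-repeat w []       f = refl
∑-repeat w (x ∷ xs) f = trans (∑-++ (List.replicate (w x) x) _ f)
  (cong₂ _+_ (∑-replicate (w x) x f) (∑-repeat w xs f))

length-repeat : (w : A → ℕ) (xs : List A) → length (repeat w xs) ≡ ∑ xs w
length-repeat w xs = trans (sym (∑-1 (repeat w xs)))
  (trans (∑-repeat w xs _) (∑-cong xs λ x → *-identityʳ (w x)))

length-cartesianProductWith : (f : A → B → C) (xs : List A) (ys : List B) →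
  length (cartesianProductWith f xs ys) ≡ length xs * length ys
length-cartesianProductWith f []       ys = refl
length-cartesianProductWith f (x ∷ xs) ys = trans (length-++ (List.map (f x) ys))
  (cong₂ _+_ (length-map (f x) ys) (length-cartesianProductWith f xs ys))

∑-cartesianProductWith : (h : A → B → C) (xs : List A) (ys : List B) (f : C → ℕ) →
  ∑ (cartesianProductWith h xs ys) f ≡ ∑ xs (λ x → ∑ ys (λ y → f (h x y)))
∑-cartesianProductWith h []       ys f = refl
∑-cartesianProductWith h (x ∷ xs) ys f = trans (∑-++ (List.map (h x) ys) _ f)
  (cong₂ _+_ (∑-map (h x) ys f) (∑-cartesianProductWith h xs ys f))

-- Tuples drawn with repetition: a sum over this list is `length xs ^ j` times the mean over a
-- random sample.
vecs : List A → ∀ j → List (Vec A j)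
vecs xs zero    = [] ∷ []
vecs xs (suc j) = cartesianProductWith _∷_ xs (vecs xs j)

length-vecs : (xs : List A) (j : ℕ) → length (vecs xs j) ≡ length xs ^ℕ j
length-vecs xs zero    = refl
length-vecs xs (suc j) = trans (length-cartesianProductWith _∷_ xs (vecs xs j))
                               (cong (length xs *_) (length-vecs xs j))

∈-vecs : {xs : List A} → (∀ x → x ∈ xs) → ∀ {j} (v : Vec A j) → v ∈ vecs xs j
∈-vecs all []      = here refl
∈-vecs all (x ∷ v) = ∈-cartesianProductWith⁺ _∷_ (all x) (∈-vecs all v)

patterns : ∀ k → List (Vec Bool k)
patterns = vecs (true ∷ false ∷ [])

∈-patterns : ∀ {k} (S : Vec Bool k) → S ∈ patterns k
∈-patterns = ∈-vecs λ { true → here refl ; false → there (here refl) }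

∑-patterns : ∀ k (f : Vec Bool (suc k) → ℕ) →
             ∑ (patterns (suc k)) f ≡ ∑ (patterns k) (f ∘ (true ∷_)) + ∑ (patterns k) (f ∘ (false ∷_))
∑-patterns k f = trans (∑-cartesianProductWith _∷_ (true ∷ false ∷ []) (patterns k) f) (cong (∑ (patterns k) (f ∘ (true ∷_)) +_) (+-identityʳ _))

𝟙 : Bool → ℕ
𝟙 b = if b then 1 else 0

𝟙≤1 : ∀ b → 𝟙 b ≤ 1
𝟙≤1 true  = ≤-refl
𝟙≤1 false = z≤n

-- Classical truth values and the Sauer-Shelah lemma

module Classical (em : ∀ {a} → ExcludedMiddle a) where

  truth : Set a → Bool
  truth U = does (em {P = U})

  truth⁺ : {U : Set a} → U → truth U ≡ true
  truth⁺ {U = U} p with em {P = U}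
  ... | yes _ = refl
  ... | no ¬p = ⊥-elim (¬p p)

  truth⁻ : {U : Set a} → truth U ≡ true → U
  truth⁻ {U = U} eq with em {P = U}
  ... | yes p = p
  ... | no _  with () ← eq

  truth-false⁺ : {U : Set a} → ¬ U → truth U ≡ false
  truth-false⁺ {U = U} ¬p with em {P = U}
  ... | yes p = ⊥-elim (¬p p)
  ... | no _  = refl

  truth-false⁻ : {U : Set a} → truth U ≡ false → ¬ U
  truth-false⁻ eq p with () ← trans (sym eq) (truth⁺ p)

  truth-cong : {U : Set a} {V : Set b} → U ⇔ V → truth U ≡ truth V
  truth-cong {U = U} e with em {P = U}
  ... | yes p = sym (truth⁺ (Equivalence.to e p))
  ... | no ¬p = sym (truth-false⁺ (¬p ∘ Equivalence.from e))

  ind : Set a → ℕ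
  ind U = 𝟙 (truth U)

  ind≤ : {U : Set a} {k : ℕ} → (U → 1 ≤ k) → ind U ≤ k
  ind≤ {U = U} h with em {P = U}
  ... | yes p = h p
  ... | no _  = z≤n

  ind⁺ : {U : Set a} → U → 1 ≤ ind U
  ind⁺ p = ≤-reflexive (sym (cong 𝟙 (truth⁺ p)))

  ind≤1 : (U : Set a) → ind U ≤ 1
  ind≤1 U = 𝟙≤1 (truth U)

  ind-mono : {U : Set a} {V : Set b} → (U → V) → ind U ≤ ind V
  ind-mono f = ind≤ (ind⁺ ∘ f)

  ind-0 : {U : Set a} → ¬ U → ind U ≡ 0
  ind-0 ¬p = cong 𝟙 (truth-false⁺ ¬p)

  count-≡ : ∀ {k} (T : Vec Bool k) → ∑ (patterns k) (λ S → ind (S ≡ T)) ≤ 1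
  count-≡ [] = ≤-trans (≤-reflexive (+-identityʳ _)) (ind≤1 _)
  count-≡ {suc k} (t ∷ T) = begin
    ∑ (patterns (suc k)) (λ S → ind (S ≡ t ∷ T))             ≡⟨ ∑-patterns k _ ⟩
    ∑ (patterns k) (λ S → ind (true ∷ S ≡ t ∷ T)) +
      ∑ (patterns k) (λ S → ind (false ∷ S ≡ t ∷ T))         ≤⟨ heads t ⟩
    ∑ (patterns k) (λ S → ind (S ≡ T))                       ≤⟨ count-≡ T ⟩
    1                                                        ∎
    where
    open ≤-Reasoning
    same : ∀ b → ∑ (patterns k) (λ S → ind (b ∷ S ≡ b ∷ T)) ≤ ∑ (patterns k) (λ S → ind (S ≡ T))
    same b = ∑-mono (patterns k) λ S → ind-mono λ { refl → refl }
    none : ∀ {b c} → b ≢ c → ∑ (patterns k) (λ S → ind (b ∷ S ≡ c ∷ T)) ≡ 0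
    none b≢c = trans (∑-cong (patterns k) λ S → ind-0 λ { refl → b≢c refl })
                     (trans (∑-const (patterns k) 0) (*-zeroʳ (length (patterns k))))
    heads : ∀ t → ∑ (patterns k) (λ S → ind (true ∷ S ≡ t ∷ T)) +
                  ∑ (patterns k) (λ S → ind (false ∷ S ≡ t ∷ T)) ≤
                  ∑ (patterns k) (λ S → ind (S ≡ T))
    heads true  = ≤-trans (+-mono-≤ (same true) (≤-reflexive (none λ ()))) (≤-reflexive (+-identityʳ _))
    heads false = +-mono-≤ (≤-reflexive (none λ ())) (same false)

  -- A bound B on the number of elements, witnessed by a list that may contain others as well;
  -- images and products of covers are then immediate.
  Cover : ℕ → {A : Set a} → (A → Set b) → Set _
  Cover B {A} U = Σ (List A) λ L → length L ≤ B × (∀ {x} → U x → x ∈ L)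

  count≤cover : ∀ {k B} {U : Vec Bool k → Set a} → Cover B U → ∑ (patterns k) (λ S → ind (U S)) ≤ B
  count≤cover {k = k} {B} {U} (L , L≤B , U⊆L) = begin
    ∑ (patterns k) (λ S → ind (U S))                  ≤⟨ ∑-mono (patterns k) (λ S → ind≤ λ p → ≤-trans (ind⁺ refl) (term≤∑ (λ T → ind (S ≡ T)) (U⊆L p))) ⟩
    ∑ (patterns k) (λ S → ∑ L (λ T → ind (S ≡ T)))    ≡⟨ ∑-swap (patterns k) L _ ⟩
    ∑ L (λ T → ∑ (patterns k) (λ S → ind (S ≡ T)))    ≤⟨ ∑-mono L count-≡ ⟩
    ∑ L (λ _ → 1)                                     ≡⟨ ∑-1 L ⟩
    length L                                          ≤⟨ L≤B ⟩
    B                                                 ∎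
    where open ≤-Reasoning

  -- The sum of the binomial coefficients (m choose i) over i < k, by Pascal's rule.
  Φ : ℕ → ℕ → ℕ
  Φ zero    m       = 0
  Φ (suc k) zero    = 1
  Φ (suc k) (suc m) = Φ (suc k) m + Φ k m

  Φ≤ : ∀ k m → Φ k m ≤ suc m ^ℕ k
  Φ≤ zero    m       = z≤n
  Φ≤ (suc k) zero    = m^n>0 1 (suc k)
  Φ≤ (suc k) (suc m) = begin
    Φ (suc k) m + Φ k m             ≤⟨ +-mono-≤ (Φ≤ (suc k) m) (Φ≤ k m) ⟩
    suc m * suc m ^ℕ k + suc m ^ℕ k   ≡⟨ +-comm (suc m * suc m ^ℕ k) _ ⟩
    suc (suc m) * suc m ^ℕ k         ≤⟨ *-monoʳ-≤ (suc (suc m)) (^-monoˡ-≤ k (n≤1+n (suc m))) ⟩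
    suc (suc m) ^ℕ suc k             ∎
    where open ≤-Reasoning

  -- Shattering in the form in which the Sauer-Shelah induction meets it, one coordinate at a time:
  -- the first coordinate is either projected away or joins the shattered set.
  -- `shattered-coordinates` recovers the set.
  ShattersSome : (k : ℕ) {m : ℕ} → (Vec Bool m → Set a) → Set a
  ShattersSome zero    U         = ∃ U
  ShattersSome (suc k) {zero}  U = Lift _ ⊥
  ShattersSome (suc k) {suc m} U = ShattersSome (suc k) (λ S → ∃ λ b → U (b ∷ S)) ⊎
                                   ShattersSome k (λ S → U (true ∷ S) × U (false ∷ S))

  shattered-coordinates : (k : ℕ) {m : ℕ} {U : Vec Bool m → Set a} → ShattersSome k U →
    Σ (Vec (Fin m) k) λ is → ∀ S → ∃ λ T → U T × Vec.map (Vec.lookup T) is ≡ S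
  shattered-coordinates zero (T , p) = [] , λ { [] → T , p , refl }
  shattered-coordinates (suc k) {suc m} {U} (inj₁ sh) =
    let is , h = shattered-coordinates (suc k) sh in
    Vec.map suc is , λ S → let T , (b , p) , eq = h S in
      b ∷ T , p , trans (sym (Vec.map-∘ (Vec.lookup (b ∷ T)) suc is)) eq
  shattered-coordinates (suc k) {suc m} {U} (inj₂ sh) =
    let is , h = shattered-coordinates k sh in
    zero ∷ Vec.map suc is , λ { (s ∷ S) → let T , p , eq = h S in
      s ∷ T , pick s p , cong (s ∷_) (trans (sym (Vec.map-∘ (Vec.lookup (s ∷ T)) suc is)) eq) }
    where
    pick : ∀ s {T} → U (true ∷ T) × U (false ∷ T) → U (s ∷ T)
    pick true  = proj₁
    pick false = proj₂

  -- A pattern in U is either its tail extended by the preferred bit `head`, or it has the other bit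
  -- and its tail has both extensions in U. The two lists of tails satisfy the recurrence of `Φ`.
  sauer-shelah : (k : ℕ) {m : ℕ} {U : Vec Bool m → Set a} → ¬ ShattersSome k U → Cover (Φ k m) U
  sauer-shelah zero            ¬sh = [] , z≤n , λ p → ⊥-elim (¬sh (_ , p))
  sauer-shelah (suc k) {zero}  ¬sh = [] ∷ [] , ≤-refl , λ { {[]} _ → here refl }
  sauer-shelah (suc k) {suc m} {U} ¬sh =
    let L₀ , ≤₀ , ⊆₀ = sauer-shelah (suc k) (¬sh ∘ inj₁)
        L₁ , ≤₁ , ⊆₁ = sauer-shelah k (¬sh ∘ inj₂)
    in
    List.map (λ S → head S ∷ S) L₀ ++ List.map (λ S → not (head S) ∷ S) L₁ ,
    ≤-trans (≤-reflexive (trans (length-++ (List.map _ L₀)) (cong₂ _+_ (length-map _ L₀) (length-map _ L₁))))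
            (+-mono-≤ ≤₀ ≤₁) ,
    λ { {b ∷ S} p → covered L₀ L₁ ⊆₀ ⊆₁ b S p }
    where
    head : Vec Bool m → Bool
    head S = truth (U (true ∷ S))
    covered : ∀ L₀ L₁ → (∀ {S} → (∃ λ b → U (b ∷ S)) → S ∈ L₀) →
              (∀ {S} → U (true ∷ S) × U (false ∷ S) → S ∈ L₁) → ∀ b S → U (b ∷ S) →
              b ∷ S ∈ List.map (λ S → head S ∷ S) L₀ ++ List.map (λ S → not (head S) ∷ S) L₁
    covered L₀ L₁ ⊆₀ ⊆₁ true S p = ∈-++⁺ˡ
      (subst (λ h → h ∷ S ∈ List.map (λ S → head S ∷ S) L₀) (truth⁺ p) (∈-map⁺ _ (⊆₀ (true , p))))
    covered L₀ L₁ ⊆₀ ⊆₁ false S p with em {P = U (true ∷ S)}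
    ... | yes q = ∈-++⁺ʳ (List.map (λ S → head S ∷ S) L₀)
      (subst (λ h → not h ∷ S ∈ List.map (λ S → not (head S) ∷ S) L₁) (truth⁺ q) (∈-map⁺ _ (⊆₁ (q , p))))
    ... | no ¬q = ∈-++⁺ˡ
      (subst (λ h → h ∷ S ∈ List.map (λ S → head S ∷ S) L₀) (truth-false⁺ ¬q) (∈-map⁺ _ (⊆₀ (false , p))))

pad : ∀ m → A → List A → Vec A m
pad zero    d l       = []
pad (suc m) d []      = d ∷ pad m d []
pad (suc m) d (x ∷ l) = x ∷ pad m d l

pad⁻ : ∀ {U : A → Set b} m d l → length l ≤ m → Allᵛ U (pad m d l) → All U l
pad⁻ m       d []      _         ps       = []
pad⁻ (suc m) d (x ∷ l) (s≤s l≤m) (p ∷ ps) = p ∷ pad⁻ m d l l≤m ps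

pad⁺ : ∀ {U : A → Set b} m d l → U d → All U l → Allᵛ U (pad m d l)
pad⁺ zero    d l       pd ps       = []
pad⁺ (suc m) d []      pd ps       = pd ∷ pad⁺ m d [] pd []
pad⁺ (suc m) d (x ∷ l) pd (p ∷ ps) = p ∷ pad⁺ m d l pd ps

map-zipWith : (f : A → A → A) (g h : X → A) {m : ℕ} (v : Vec X m) →
  Vec.map (λ x → f (g x) (h x)) v ≡ Vec.zipWith f (Vec.map g v) (Vec.map h v)
map-zipWith f g h []      = refl
map-zipWith f g h (x ∷ v) = cong (f (g x) (h x) ∷_) (map-zipWith f g h v)

map-lookup : (f : A → B) {m k : ℕ} (v : Vec A m) (is : Vec (Fin m) k) →
  Vec.map (Vec.lookup (Vec.map f v)) is ≡ Vec.map f (Vec.map (Vec.lookup v) is)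
map-lookup f v []       = refl
map-lookup f v (i ∷ is) = cong₂ _∷_ (Vec.lookup-map i f v) (map-lookup f v is)

map-cong⁻ : (f g : A → B) {m : ℕ} (v : Vec A m) → Vec.map f v ≡ Vec.map g v → Allᵛ (λ x → f x ≡ g x) v
map-cong⁻ f g []      _  = []
map-cong⁻ f g (x ∷ v) eq = Vec.∷-injectiveˡ eq ∷ map-cong⁻ f g v (Vec.∷-injectiveʳ eq)

map-cong⁺ : (f g : A → B) {m : ℕ} {v : Vec A m} → Allᵛ (λ x → f x ≡ g x) v → Vec.map f v ≡ Vec.map g v
map-cong⁺ f g []       = refl
map-cong⁺ f g (e ∷ es) = cong₂ _∷_ e (map-cong⁺ f g es)

-- Set systems of finite VC-dimension

Trace : (C → X → Bool) → ∀ {m} → Vec X m → Vec Bool m → Set _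
Trace R v S = ∃ λ c → Vec.map (R c) v ≡ S

-- A vector with a repeated entry is never shattered, so that no vector of length k is shattered
-- means VC-dimension less than k.
Shattered : (C → X → Bool) → ∀ {m} → Vec X m → Set _
Shattered R v = ∀ S → Trace R v S

module Combinatorics (em : ∀ {a} → ExcludedMiddle a) where
  open Classical em

  traces-cover : ∀ {C : Set c} {X : Set x} {R : C → X → Bool} k →
    (∀ (v : Vec X k) → ¬ Shattered R v) → ∀ {m} (v : Vec X m) → Cover (Φ k m) (Trace R v)
  traces-cover {R = R} k vc v = sauer-shelah k λ sh →
    let is , h = shattered-coordinates k sh in
    vc (Vec.map (Vec.lookup v) is) λ S → let _ , (c , eq) , eq′ = h S in
      c , trans (sym (map-lookup (R c) v is)) (trans (cong (λ T → Vec.map (Vec.lookup T) is) eq) eq′)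

  dual : ℕ → ℕ
  dual k = length (patterns k)

  -- If `dual k` = 2 ^ k concepts were shattered by points, index them by the patterns of length k:
  -- the k points that pick out the concepts whose i-th bit is true would be shattered by these
  -- concepts.
  dual-VC : ∀ {C : Set c} {X : Set x} {R : C → X → Bool} k →
    (∀ (v : Vec X k) → ¬ Shattered R v) → ∀ (w : Vec C (dual k)) → ¬ Shattered (flip R) w
  dual-VC {C = C} {X} {R} k vc w sh = vc (Vec.tabulate point) λ S →
    Vec.lookup w (index S) , (begin
      Vec.map (R (Vec.lookup w (index S))) (Vec.tabulate point) ≡⟨ Vec.tabulate-∘ _ point ⟨
      Vec.tabulate (λ i → R (Vec.lookup w (index S)) (point i)) ≡⟨ Vec.tabulate-cong (value S) ⟩
      Vec.tabulate (Vec.lookup S)                               ≡⟨ Vec.tabulate∘lookup S ⟩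
      S                                                         ∎)
    where
    open ≡-Reasoning
    index : Vec Bool k → Fin (dual k)
    index S = Any.index (∈-patterns S)
    column : Fin k → Vec Bool (dual k)
    column i = Vec.tabulate λ j → Vec.lookup (List.lookup (patterns k) j) i
    point : Fin k → X
    point i = proj₁ (sh (column i))
    value : ∀ S i → R (Vec.lookup w (index S)) (point i) ≡ Vec.lookup S i
    value S i = begin
      R (Vec.lookup w (index S)) (point i)                          ≡⟨ Vec.lookup-map (index S) _ w ⟨
      Vec.lookup (Vec.map (flip R (point i)) w) (index S)           ≡⟨ cong (λ T → Vec.lookup T (index S)) (proj₂ (sh (column i))) ⟩
      Vec.lookup (column i) (index S)                               ≡⟨ Vec.lookup∘tabulate _ (index S) ⟩
      Vec.lookup (List.lookup (patterns k) (index S)) i             ≡⟨ cong (λ T → Vec.lookup T i) (sym (lookup-index (∈-patterns S))) ⟩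
      Vec.lookup S i                                                ∎

  -- The ε-net theorem by averaging the number of traces

  module EpsilonNet {C : Set c} {X : Set x} (R : C → X → Bool) (K : ℕ) (xs : List X) where

    mass : C → ℕ
    mass c = ∑ xs (λ x → 𝟙 (R c x))

    Heavy : C → Set
    Heavy c = length xs < K * mass c

    Missed : List X → Set _
    Missed l = ∃ λ c → Heavy c × All (λ x → R c x ≡ false) l

    HeavyTrace : List X → ∀ {j} → Vec X j → Vec Bool j → Set _
    HeavyTrace l v S = ∃ λ c → Heavy c × All (λ x → R c x ≡ false) l × Vec.map (R c) v ≡ S

    traceCount : List X → ∀ {j} → Vec X j → ℕ
    traceCount l {j} v = ∑ (patterns j) (λ S → ind (HeavyTrace l v S))

    -- If every small set is missed by a heavy concept, a random j-tuple has on average at least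
    -- (1 + 1/K) ^ j traces: a coordinate x in a pattern is either added to the missed set l, or it is
    -- hit with probability at least 1/K by the concept chosen for the remaining coordinates.
    average-traceCount : ∀ j l → (∀ l′ → length l′ ≤ j + length l → Missed l′) →
      length xs ^ℕ j * suc K ^ℕ j ≤ K ^ℕ j * ∑ (vecs xs j) (traceCount l)
    average-traceCount zero l missed =
      let c , heavy , miss = missed l ≤-refl in
      ≤-trans (ind⁺ {U = HeavyTrace l [] []} (c , heavy , miss , refl))
              (≤-reflexive (lemma (ind (HeavyTrace l [] []))))
      where
      lemma : ∀ i → i ≡ 1 * (i + 0 + 0)
      lemma = solve-∀
    average-traceCount (suc j) l missed = begin
      -- Of the factor K + 1, the part K is supplied by the patterns beginning with `false` and the
      -- part 1 by those beginning with `true`.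
      n * n ^ℕ j * (suc K * suc K ^ℕ j)          ≡⟨ lemma₁ n (n ^ℕ j) K (suc K ^ℕ j) ⟩
      K * (n * N) + n * N                      ≤⟨ +-mono-≤ (*-monoʳ-≤ K misses) hits ⟩
      K * (G * ∑F) + G * (K * ∑T)              ≡⟨ lemma₂ K G ∑F ∑T ⟩
      K * G * (∑T + ∑F)                        ≡⟨ cong (K * G *_) split ⟨
      K * G * ∑ (vecs xs (suc j)) (traceCount l) ∎
      where
      open ≤-Reasoning
      n = length xs
      N = n ^ℕ j * suc K ^ℕ j
      G = K ^ℕ j
      part : Bool → X → Vec X j → ℕ
      part b x v = ∑ (patterns j) (λ S → ind (HeavyTrace l (x ∷ v) (b ∷ S)))
      ∑T = ∑ xs (λ x → ∑ (vecs xs j) (part true x))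
      ∑F = ∑ xs (λ x → ∑ (vecs xs j) (part false x))
      lemma₁ : ∀ n u K v → n * u * (suc K * v) ≡ K * (n * (u * v)) + n * (u * v)
      lemma₁ = solve-∀
      lemma₂ : ∀ K G f t → K * (G * f) + G * (K * t) ≡ K * G * (t + f)
      lemma₂ = solve-∀
      split : ∑ (vecs xs (suc j)) (traceCount l) ≡ ∑T + ∑F
      split = trans (∑-cartesianProductWith _∷_ xs (vecs xs j) _) (trans
        (∑-cong xs λ x → trans (∑-cong (vecs xs j) λ v → ∑-patterns j _)
                               (∑-+ (vecs xs j) (part true x) (part false x)))
        (∑-+ xs _ _))
      misses : n * N ≤ G * ∑F
      misses = begin
        n * N                                            ≡⟨ ∑-const xs N ⟨
        ∑ xs (λ _ → N)                                   ≤⟨ ∑-mono xs (λ x → begin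
          N                                                ≤⟨ average-traceCount j (x ∷ l) (λ l′ l′≤ → missed l′ (≤-trans l′≤ (≤-reflexive (+-suc j _)))) ⟩
          G * ∑ (vecs xs j) (traceCount (x ∷ l))           ≤⟨ *-monoʳ-≤ G (∑-mono (vecs xs j) λ v → ∑-mono (patterns j) λ S → ind-mono
                                                               λ { (c , heavy , x∉c ∷ miss , eq) → c , heavy , miss , cong₂ _∷_ x∉c eq }) ⟩
          G * ∑ (vecs xs j) (part false x)                 ∎) ⟩
        ∑ xs (λ x → G * ∑ (vecs xs j) (part false x))    ≡⟨ ∑-* G xs _ ⟩
        G * ∑F                                           ∎
      hit : ∀ v S → n * ind (HeavyTrace l v S) ≤ K * ∑ xs (λ x → ind (HeavyTrace l (x ∷ v) (true ∷ S)))
      hit v S with em {P = HeavyTrace l v S}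
      ... | no _ = ≤-trans (≤-reflexive (*-zeroʳ n)) z≤n
      ... | yes (c , heavy , miss , eq) = begin
        n * 1                                                          ≡⟨ *-identityʳ n ⟩
        n                                                              ≤⟨ <⇒≤ heavy ⟩
        K * mass c                                                     ≤⟨ *-monoʳ-≤ K (∑-mono xs contains) ⟩
        K * ∑ xs (λ x → ind (HeavyTrace l (x ∷ v) (true ∷ S)))         ∎
        where
        contains : ∀ x → 𝟙 (R c x) ≤ ind (HeavyTrace l (x ∷ v) (true ∷ S))
        contains x with R c x in x∈c
        ... | false = z≤n
        ... | true  = ind⁺ (c , heavy , miss , cong₂ _∷_ x∈c eq)
      hits : n * N ≤ G * (K * ∑T)
      hits = begin
        n * N                                                          ≤⟨ *-monoʳ-≤ n (average-traceCount j l λ l′ l′≤ → missed l′ (m≤n⇒m≤1+n l′≤)) ⟩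
        n * (G * ∑ (vecs xs j) (traceCount l))                         ≡⟨ lemma n G _ ⟩
        G * (n * ∑ (vecs xs j) (traceCount l))                         ≡⟨ cong (G *_) (∑-* n (vecs xs j) _) ⟨
        G * ∑ (vecs xs j) (λ v → n * traceCount l v)                   ≤⟨ *-monoʳ-≤ G (∑-mono (vecs xs j) per-tuple) ⟩
        G * ∑ (vecs xs j) (λ v → K * ∑ xs (λ x → part true x v))       ≡⟨ cong (G *_) (∑-* K (vecs xs j) _) ⟩
        G * (K * ∑ (vecs xs j) (λ v → ∑ xs (λ x → part true x v)))     ≡⟨ cong (λ s → G * (K * s)) (∑-swap (vecs xs j) xs _) ⟩
        G * (K * ∑T)                                                   ∎
        where
        lemma : ∀ n G s → n * (G * s) ≡ G * (n * s)
        lemma = solve-∀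
        per-tuple : ∀ v → n * traceCount l v ≤ K * ∑ xs (λ x → part true x v)
        per-tuple v = begin
          n * traceCount l v                                                              ≡⟨ ∑-* n (patterns j) _ ⟨
          ∑ (patterns j) (λ S → n * ind (HeavyTrace l v S))                               ≤⟨ ∑-mono (patterns j) (hit v) ⟩
          ∑ (patterns j) (λ S → K * ∑ xs (λ x → ind (HeavyTrace l (x ∷ v) (true ∷ S))))   ≡⟨ ∑-* K (patterns j) _ ⟩
          K * ∑ (patterns j) (λ S → ∑ xs (λ x → ind (HeavyTrace l (x ∷ v) (true ∷ S))))   ≡⟨ cong (K *_) (∑-swap (patterns j) xs _) ⟩
          K * ∑ xs (λ x → part true x v)                                                  ∎

    -- Without a net every list of at most m points is missed by a heavy concept, so the average
    -- number of traces is at least (1 + 1/K) ^ m; but no m-tuple has more than B.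
    ε-net : ∀ m {B} → (∀ (v : Vec X m) → Cover B (Trace R v)) → B * K ^ℕ m < suc K ^ℕ m →
            X → 0 < length xs → Σ (Vec X m) λ e → ∀ c → Allᵛ (λ x → R c x ≡ false) e → ¬ Heavy c
    ε-net m {B} covers small x₀ nonempty
      with em {P = Σ (Vec X m) λ e → ∀ c → Allᵛ (λ x → R c x ≡ false) e → ¬ Heavy c}
    ... | yes net = net
    ... | no ¬net = ⊥-elim (<-irrefl refl (begin-strict
        length xs ^ℕ m * suc K ^ℕ m                  ≤⟨ average-traceCount m [] (λ l l≤ → missed l (≤-trans l≤ (≤-reflexive (+-identityʳ m)))) ⟩
        K ^ℕ m * ∑ (vecs xs m) (traceCount [])      ≤⟨ *-monoʳ-≤ (K ^ℕ m) (∑-mono (vecs xs m) few) ⟩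
        K ^ℕ m * ∑ (vecs xs m) (λ _ → B)            ≡⟨ cong (K ^ℕ m *_) (trans (∑-const (vecs xs m) B) (cong (_* B) (length-vecs xs m))) ⟩
        K ^ℕ m * (length xs ^ℕ m * B)                ≡⟨ lemma (K ^ℕ m) (length xs ^ℕ m) B ⟩
        length xs ^ℕ m * (B * K ^ℕ m)                <⟨ *-monoʳ-< (length xs ^ℕ m) {{m^n≢0 (length xs) m {{>-nonZero nonempty}}}} small ⟩
        length xs ^ℕ m * suc K ^ℕ m                  ∎))
      where
      open ≤-Reasoning
      lemma : ∀ k n b → k * (n * b) ≡ n * (b * k)
      lemma = solve-∀
      missed : ∀ l → length l ≤ m → Missed l
      missed l l≤m with em {P = Missed l}
      ... | yes miss = miss
      ... | no ¬miss = ⊥-elim (¬net (pad m x₀ l , λ c none heavy → ¬miss (c , heavy , pad⁻ m x₀ l l≤m none)))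
      few : ∀ v → traceCount [] v ≤ B
      few v = ≤-trans (∑-mono (patterns m) λ S → ind-mono λ { (c , _ , _ , eq) → c , eq }) (count≤cover (covers v))

-- Along q, b, b′, q′ the value changes somewhere; summed over hypotheses, this bounds the
-- non-separating ones by the errors.
xor-≢ : ∀ {q q′} b b′ → q ≢ q′ → 1 ≤ 𝟙 (b xor b′) + (𝟙 (b xor q) + 𝟙 (b′ xor q′))
xor-≢ true  false _ = s≤s z≤n
xor-≢ false true  _ = s≤s z≤n
xor-≢ {true}  {true}  true  true  q≢q′ = ⊥-elim (q≢q′ refl)
xor-≢ {true}  {false} true  true  _    = s≤s z≤n
xor-≢ {false} {_}     true  true  _    = s≤s z≤n
xor-≢ {true}  {_}     false false _    = s≤s z≤n
xor-≢ {false} {true}  false false _    = s≤s z≤n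
xor-≢ {false} {false} false false q≢q′ = ⊥-elim (q≢q′ refl)

-- Boosting and compression of the hypotheses

module Boosting (em : ∀ {a} → ExcludedMiddle a) where
  open Classical em
  open Combinatorics em

  -- The argument 30 stands for K = 31, a relative error of 1/31, which balances the extra weight 31
  -- that an error brings in `boost`.
  sampleSize : ℕ → ℕ
  sampleSize k = proj₁ (polynomial<exponential 1 k 30)

  sampleSize-small : ∀ k → Φ k (sampleSize k) * 31 ^ℕ sampleSize k < 32 ^ℕ sampleSize k
  sampleSize-small k = ≤-<-trans
    (*-monoˡ-≤ (31 ^ℕ m) (≤-trans (Φ≤ k m) (≤-reflexive (sym (*-identityˡ _)))))
    (proj₂ (polynomial<exponential 1 k 30))
    where
    m = sampleSize k

  -- The argument 2 stands for K = 3. The exponent is doubled because a separating set is the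
  -- symmetric difference of two sets of the dual system, so trace bounds are squared.
  hypothesisCount : ℕ → ℕ
  hypothesisCount k = proj₁ (polynomial<exponential 1 (dual k + dual k) 2)

  hypothesisCount-small : ∀ k → let m = hypothesisCount k in
    (Φ (dual k) m * Φ (dual k) m) * 3 ^ℕ m < 4 ^ℕ m
  hypothesisCount-small k = ≤-<-trans (*-monoˡ-≤ (3 ^ℕ m) (begin
      Φ (dual k) m * Φ (dual k) m        ≤⟨ *-mono-≤ (Φ≤ (dual k) m) (Φ≤ (dual k) m) ⟩
      suc m ^ℕ dual k * suc m ^ℕ dual k    ≡⟨ ^-distribˡ-+-* (suc m) (dual k) (dual k) ⟨
      suc m ^ℕ (dual k + dual k)          ≡⟨ *-identityˡ _ ⟨
      1 * suc m ^ℕ (dual k + dual k)      ∎))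
    (proj₂ (polynomial<exponential 1 (dual k + dual k) 2))
    where
    open ≤-Reasoning
    m = hypothesisCount k

  -- Hypotheses are kept apart from the concepts in Y because a hypothesis will also carry the
  -- parameters that select its value.
  module _ {y h} {Y : Set y} {Hyp : Set h} {n : ℕ} (a₀ : Fin n)
    (R : Y → Fin n → Bool) (p : Fin n → Bool)
    (k : ℕ) (vc : ∀ (v : Vec (Fin n) k) → ¬ Shattered R v) (val : Hyp → Y)
    (fit : (e : Vec (Fin n) (sampleSize k)) → Σ Hyp λ h → Allᵛ (λ a → R (val h) a ≡ p a) e) where

    points : List (Fin n)
    points = List.allFin n

    err : Hyp → Fin n → ℕ
    err h a = 𝟙 (R (val h) a xor p a)

    errs : List Hyp → Fin n → ℕ
    errs hs a = ∑ hs (λ h → err h a)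

    -- Taking `_xor_` with the fixed labelling p does not increase the number of traces, so the
    -- error sets have a net of size `sampleSize k`; a hypothesis that fits p there has an error set
    -- missing the net.
    weak-learner : (as : List (Fin n)) → 0 < length as → ∃ λ h → 31 * ∑ as (err h) ≤ length as
    weak-learner as nonempty =
      let e , net = EpsilonNet.ε-net wrong 31 as (sampleSize k) covers (sampleSize-small k) a₀ nonempty
          h , agree = fit e
      in h , ≮⇒≥ (net (val h) (Allᵛ.map (λ {a} eq → trans (cong (_xor p a) eq) (xor-same (p a))) agree))
      where
      wrong : Y → Fin n → Bool
      wrong b a = R b a xor p a
      covers : ∀ {m} (v : Vec (Fin n) m) → Cover (Φ k m) (Trace wrong v)
      covers v =
        let L , L≤ , ⊆L = traces-cover k vc v in
        List.map (λ S → Vec.zipWith _xor_ S (Vec.map p v)) L ,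
        ≤-trans (≤-reflexive (length-map _ L)) L≤ ,
        λ { (b , refl) → subst (_∈ _) (sym (map-zipWith _xor_ (R b) p v))
                           (∈-map⁺ (λ S → Vec.zipWith _xor_ S (Vec.map p v)) (⊆L (b , refl))) }

    -- Weighting a by 32 ^ errs hs a, each further hypothesis has relative error at most 1/31, so it at
    -- most doubles the total weight.
    boost : ∀ t → Σ (List Hyp) λ hs → length hs ≡ t × ∑ points (λ a → 32 ^ℕ errs hs a) ≤ 2 ^ℕ t * n
    boost zero = [] , refl , ≤-reflexive (begin
      ∑ points (λ _ → 1)     ≡⟨ ∑-1 points ⟩
      length points          ≡⟨ length-tabulate {n = n} _ ⟩
      n                      ≡⟨ *-identityˡ n ⟨
      1 * n                  ∎)
      where open ≡-Reasoning
    boost (suc t) =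
      let hs , len , bound = boost t
          w = λ a → 32 ^ℕ errs hs a
          as = repeat w points
          W≡ = length-repeat w points
          h , weak = weak-learner as (≤-trans (≤-trans (m^n>0 32 (errs hs a₀)) (term≤∑ w (∈-allFin a₀)))
                                              (≤-reflexive (sym W≡)))
      in h ∷ hs , cong suc len , (begin
        ∑ points (λ a → 32 ^ℕ (err h a + errs hs a))           ≤⟨ ∑-mono points (λ a → update (R (val h) a xor p a) (errs hs a)) ⟩
        ∑ points (λ a → w a + 31 * (w a * err h a))           ≡⟨ ∑-+ points w _ ⟩
        ∑ points w + ∑ points (λ a → 31 * (w a * err h a))    ≡⟨ cong (∑ points w +_) (∑-* 31 points _) ⟩
        ∑ points w + 31 * ∑ points (λ a → w a * err h a)      ≡⟨ cong (λ s → ∑ points w + 31 * s) (∑-repeat w points (err h)) ⟨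
        ∑ points w + 31 * ∑ as (err h)                        ≤⟨ +-monoʳ-≤ (∑ points w) (≤-trans weak (≤-reflexive W≡)) ⟩
        ∑ points w + ∑ points w                               ≤⟨ +-mono-≤ bound bound ⟩
        2 ^ℕ t * n + 2 ^ℕ t * n                                 ≡⟨ lemma (2 ^ℕ t) n ⟩
        2 ^ℕ suc t * n                                         ∎)
      where
      open ≤-Reasoning
      lemma : ∀ u n → u * n + u * n ≡ 2 * u * n
      lemma = solve-∀
      update : ∀ b e → 32 ^ℕ (𝟙 b + e) ≤ 32 ^ℕ e + 31 * (32 ^ℕ e * 𝟙 b)
      update true  e = ≤-reflexive (lemma₁ (32 ^ℕ e))
        where
        lemma₁ : ∀ x → 32 * x ≡ x + 31 * (x * 1)
        lemma₁ = solve-∀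
      update false e = m≤m+n _ _

    -- A point with n errors would alone have weight 32 ^ n = 2 ^ (4n) * 2 ^ n, more than the total
    -- allowed after 4n rounds.
    few-errors : ∃ λ hs → length hs ≡ 4 * n × (∀ a → errs hs a < n)
    few-errors =
      let hs , len , bound = boost (4 * n) in hs , len , λ a → ≰⇒> λ n≤errs → <-irrefl refl (begin-strict
        32 ^ℕ n                            ≤⟨ ^-monoʳ-≤ 32 n≤errs ⟩
        32 ^ℕ errs hs a                    ≤⟨ term≤∑ (λ a → 32 ^ℕ errs hs a) (∈-allFin a) ⟩
        ∑ points (λ a → 32 ^ℕ errs hs a)   ≤⟨ bound ⟩
        2 ^ℕ (4 * n) * n                   <⟨ *-monoʳ-< (2 ^ℕ (4 * n)) {{m^n≢0 2 (4 * n)}} (n<2^n n) ⟩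
        2 ^ℕ (4 * n) * 2 ^ℕ n               ≡⟨ cong (_* 2 ^ℕ n) (^-*-assoc 2 4 n) ⟨
        16 ^ℕ n * 2 ^ℕ n                    ≡⟨ *-^-distrib 16 2 n ⟨
        32 ^ℕ n                            ∎)
      where open ≤-Reasoning

    -- Hypotheses correct at both a and a′ separate them, and these form a large set; so an ε-net for
    -- the separating sets distinguishes a from a′ whenever p does.
    separating-hypotheses : Σ (Vec Hyp (hypothesisCount k)) λ hs → ∀ a a′ →
      Vec.map (λ h → R (val h) a) hs ≡ Vec.map (λ h → R (val h) a′) hs → p a ≡ p a′
    separating-hypotheses =
      let all , len , few = few-errors
          -- Only a default with which `ε-net` pads short lists; fitting a constant sample supplies
          -- one.
          h₀ = proj₁ (fit (Vec.replicate _ a₀))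
          n>0 = ≤-<-trans z≤n (few a₀)
          e , net = EpsilonNet.ε-net separates 3 all (hypothesisCount k) covers (hypothesisCount-small k) h₀
                      (≤-trans (≤-trans n>0 (m≤m+n n (3 * n))) (≤-reflexive (sym len)))
      in e , λ a a′ eq → decidable-stable (p a ≟ᵇ p a′) λ p≢p′ →
           net (a , a′) (Allᵛ.map (λ {h} eq → trans (cong (_xor R (val h) a′) eq) (xor-same (R (val h) a′)))
                                  (map-cong⁻ _ _ e eq))
             (heavy all len a a′ (few a) (few a′) p≢p′)
      where
      separates : Fin n × Fin n → Hyp → Bool
      separates (a , a′) h = R (val h) a xor R (val h) a′
      covers : ∀ {m} (v : Vec Hyp m) → Cover (Φ (dual k) m * Φ (dual k) m) (Trace separates v)
      covers v =
        let L , L≤ , ⊆L = traces-cover {R = flip R} (dual k) (dual-VC k vc) (Vec.map val v)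
        in
        cartesianProductWith (Vec.zipWith _xor_) L L ,
        ≤-trans (≤-reflexive (length-cartesianProductWith (Vec.zipWith _xor_) L L)) (*-mono-≤ L≤ L≤) ,
        λ { ((a , a′) , refl) → subst (_∈ cartesianProductWith (Vec.zipWith _xor_) L L)
              (sym (map-zipWith _xor_ (λ h → R (val h) a) (λ h → R (val h) a′) v))
              (∈-cartesianProductWith⁺ (Vec.zipWith _xor_) (subst (_∈ L) (sym (Vec.map-∘ _ val v)) (⊆L (a , refl)))
                                       (subst (_∈ L) (sym (Vec.map-∘ _ val v)) (⊆L (a′ , refl)))) }
      heavy : ∀ hs → length hs ≡ 4 * n → ∀ a a′ → errs hs a < n → errs hs a′ < n → p a ≢ p a′ →
              length hs < 3 * ∑ hs (λ h → 𝟙 (separates (a , a′) h))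
      heavy hs len a a′ ea ea′ p≢p′ = begin-strict
        length hs      ≡⟨ len ⟩
        4 * n          <⟨ arithmetic n sep (errs hs a) (errs hs a′) ea ea′ total ⟩
        3 * sep        ∎
        where
        open ≤-Reasoning
        sep = ∑ hs (λ h → 𝟙 (separates (a , a′) h))
        total : 4 * n ≤ sep + (errs hs a + errs hs a′)
        total = begin
          4 * n                          ≡⟨ trans (∑-1 hs) len ⟨
          ∑ hs (λ _ → 1)                 ≤⟨ ∑-mono hs (λ h → xor-≢ (R (val h) a) (R (val h) a′) p≢p′) ⟩
          ∑ hs (λ h → 𝟙 (separates (a , a′) h) + (err h a + err h a′)) ≡⟨ ∑-+ hs _ _ ⟩
          sep + ∑ hs (λ h → err h a + err h a′)  ≡⟨ cong (sep +_) (∑-+ hs _ _) ⟩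
          sep + (errs hs a + errs hs a′) ∎
        arithmetic : ∀ n s e e′ → e < n → e′ < n → 4 * n ≤ s + (e + e′) → 4 * n < 3 * s
        arithmetic n s e e′ e<n e′<n total = begin-strict
          4 * n                <⟨ m<m+n (4 * n) {2} (s≤s z≤n) ⟩
          4 * n + 2            ≤⟨ +-monoˡ-≤ 2 (m≤m+n (4 * n) (2 * n)) ⟩
          4 * n + 2 * n + 2    ≡⟨ lemma₁ n ⟩
          3 * (2 * n) + 2      ≤⟨ +-monoʳ-≤ (3 * (2 * n)) (s≤s (s≤s z≤n)) ⟩
          3 * (2 * n) + 6      ≡⟨ lemma₂ n ⟩
          3 * (2 * n + 2)      ≤⟨ *-monoʳ-≤ 3 (+-cancelʳ-≤ (e + e′) (2 * n + 2) s (begin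
            2 * n + 2 + (e + e′)           ≡⟨ lemma₃ n e e′ ⟩
            2 * n + (suc e + suc e′)       ≤⟨ +-monoʳ-≤ (2 * n) (+-mono-≤ e<n e′<n) ⟩
            2 * n + (n + n)                ≡⟨ lemma₄ n ⟩
            4 * n                          ≤⟨ total ⟩
            s + (e + e′)                   ∎)) ⟩
          3 * s ∎
          where
          lemma₁ : ∀ n → 4 * n + 2 * n + 2 ≡ 3 * (2 * n) + 2
          lemma₁ = solve-∀
          lemma₂ : ∀ n → 3 * (2 * n) + 6 ≡ 3 * (2 * n + 2)
          lemma₂ = solve-∀
          lemma₃ : ∀ n e e′ → 2 * n + 2 + (e + e′) ≡ 2 * n + (suc e + suc e′)
          lemma₃ = solve-∀
          lemma₄ : ∀ n → 2 * n + (n + n) ≡ 4 * n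
          lemma₄ = solve-∀

    -- By separation p factors through the vector of values; F is `true` exactly on the vectors
    -- attained at a point labelled `true`.
    decoder : Σ (Vec Hyp (hypothesisCount k)) λ hs → ∃ λ F → ∀ a → p a ≡ F (Vec.map (λ h → R (val h) a) hs)
    decoder = hs , F , λ a → correct a (p a) refl
      where
      hs = proj₁ separating-hypotheses
      F : Vec Bool (hypothesisCount k) → Bool
      F S = truth (∃ λ a → Vec.map (λ h → R (val h) a) hs ≡ S × p a ≡ true)
      correct : ∀ a b → p a ≡ b → b ≡ F (Vec.map (λ h → R (val h) a) hs)
      correct a true  eq = sym (truth⁺ (a , refl , eq))
      correct a false eq = sym (truth-false⁺ λ { (a′ , eq′ , pa′) →
        case trans (sym pa′) (trans (proj₂ separating-hypotheses a′ a eq′) eq) of λ () })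

-- Labelled samples and teaching sets

Agrees : (X → Bool) → List (X × Bool) → Set _
Agrees f = All (λ (x , β) → f x ≡ β)

label : ∀ {m} → Vec X m → Vec Bool m → List (X × Bool)
label v S = Vec.toList (Vec.zip v S)

length-label : ∀ {m} (v : Vec X m) (S : Vec Bool m) → length (label v S) ≡ m
length-label v S = Vec.length-toList (Vec.zip v S)

label⁺ : ∀ (f : X → Bool) {m} (v : Vec X m) {S} → Vec.map f v ≡ S → Agrees f (label v S)
label⁺ f []      refl = []
label⁺ f (x ∷ v) refl = refl ∷ label⁺ f v refl

label⁻ : ∀ (f : X → Bool) {m} (v : Vec X m) S → Agrees f (label v S) → Vec.map f v ≡ S
label⁻ f []      []      []       = refl
label⁻ f (x ∷ v) (s ∷ S) (e ∷ es) = cong₂ _∷_ e (label⁻ f v S es)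

tabulate-≡⁻ : ∀ {n} {f g : Fin n → A} → Vec.tabulate f ≡ Vec.tabulate g → ∀ i → f i ≡ g i
tabulate-≡⁻ {f = f} {g} eq i =
  trans (sym (Vec.lookup∘tabulate f i)) (trans (cong (λ v → Vec.lookup v i) eq) (Vec.lookup∘tabulate g i))

module TeachingSets (em : ∀ {a} → ExcludedMiddle a) where
  open Classical em
  open Combinatorics em

  length-filter-¬ : (U : A → Set b) (xs : List A) →
    length (filter (λ x → em {P = ¬ U x}) xs) + ∑ xs (λ x → ind (U x)) ≡ length xs
  length-filter-¬ U []       = refl
  length-filter-¬ U (x ∷ xs) with em {P = ¬ U x} | em {P = U x}
  ... | yes ¬p | yes p = ⊥-elim (¬p p)
  ... | yes ¬p | no _  = cong suc (length-filter-¬ U xs)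
  ... | no ¬¬p | yes p = trans (+-suc _ _) (cong suc (length-filter-¬ U xs))
  ... | no ¬¬p | no ¬p = ⊥-elim (¬¬p ¬p)

  -- There are only `dual k` patterns: if each served fewer than m of the points, at most
  -- `dual k * m` points would be served.
  pigeonhole : ∀ k m {U : Vec Bool k → A → Set b} (xs : List A) → dual k * m < length xs →
    All (λ x → ∃ λ s → U s x) xs → ∃ λ s → length (filter (λ x → em {P = ¬ U s x}) xs) + m ≤ length xs
  pigeonhole k m {U} xs many classified with em {P = ∃ λ s → m ≤ ∑ xs (λ x → ind (U s x))}
  ... | yes (s , m≤) = s , ≤-trans (+-monoʳ-≤ _ m≤) (≤-reflexive (length-filter-¬ (U s) xs))
  ... | no ¬large = ⊥-elim (<-irrefl refl (begin-strict
      dual k * m                                              <⟨ many ⟩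
      length xs                                               ≤⟨ count xs classified ⟩
      ∑ xs (λ x → ∑ (patterns k) (λ s → ind (U s x)))         ≡⟨ ∑-swap xs (patterns k) _ ⟩
      ∑ (patterns k) (λ s → ∑ xs (λ x → ind (U s x)))         ≤⟨ ∑-mono (patterns k) (λ s → <⇒≤ (≰⇒> λ m≤ → ¬large (s , m≤))) ⟩
      ∑ (patterns k) (λ _ → m)                                ≡⟨ ∑-const (patterns k) m ⟩
      dual k * m                                              ∎))
    where
    open ≤-Reasoning
    count : ∀ xs → All (λ x → ∃ λ s → U s x) xs → length xs ≤ ∑ xs (λ x → ∑ (patterns k) (λ s → ind (U s x)))
    count []       []              = z≤n
    count (x ∷ xs) ((s , p) ∷ ps) = +-mono-≤
      (≤-trans (ind⁺ p) (term≤∑ (λ s → ind (U s x)) (∈-patterns s))) (count xs ps)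

  -- The recursion adds `bound` of `Descent`: beyond `dual κ * κ` labelled points, some κ of them
  -- share a forcing pattern and make room for the κ points of Z.
  teachingSize : ℕ → ℕ
  teachingSize zero          = 0
  teachingSize (suc zero)    = 0
  teachingSize (suc (suc k)) = dual (suc k) * suc k + suc k + teachingSize (suc k)

  -- Only some concept has to be taught. Teaching every concept has no bound in terms of the
  -- VC-dimension: among the singletons and the empty set, the latter needs every point.
  TeachingSet : ∀ {n} {C : Set c} → (C → Fin n → Bool) → ℕ → Set _
  TeachingSet {n = n} R t = Σ (List (Fin n × Bool)) λ γ → length γ ≤ t × ∃ λ c → Agrees (R c) γ ×
    (∀ c′ → Agrees (R c′) γ → ∀ a → R c′ a ≡ R c a)

  -- The argument of Chen, Cheng and Tang: if the concepts agreeing with γ still shatter some Z of size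
  -- κ, then, Z ∪ {x} not being shattered for (x , β) in γ, some pattern s on Z forces x to have label
  -- β.  Trading many labelled points sharing such an s for (Z , s) leaves strictly fewer concepts.
  module Descent {n : ℕ} {C : Set c} (k : ℕ) (R : C → Fin n → Bool)
    (vc : ∀ (v : Vec (Fin n) (suc (suc k))) → ¬ Shattered R v)
    (teach-smaller : ∀ {C : Set c} (R : C → Fin n → Bool) → (∀ (v : Vec (Fin n) (suc k)) → ¬ Shattered R v) →
                     C → TeachingSet R (teachingSize (suc k))) where

    κ bound : ℕ
    κ     = suc k
    bound = dual κ * κ + κ

    Forces : Vec (Fin n) κ → Vec Bool κ → Fin n × Bool → Set _
    Forces Z s (x , β) = ∀ c → Vec.map (R c) Z ≡ s → R c x ≡ β

    Restricted : List (Fin n × Bool) → Set _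
    Restricted γ = Σ C λ c → Agrees (R c) γ

    forcing-pattern : ∀ Z {γ} → Shattered {C = Restricted γ} (R ∘ proj₁) Z → ∀ {z} → z ∈ γ → ∃ λ s → Forces Z s z
    forcing-pattern Z sh {x , β} z∈ with em {P = ∃ λ s → Forces Z s (x , β)}
    ... | yes forced = forced
    ... | no ¬forced = ⊥-elim (vc (x ∷ Z) realised)
      where
      realised : Shattered R (x ∷ Z)
      realised (b ∷ s) with b ≟ᵇ β
      -- Concepts agreeing with γ realise every pattern on Z and give x the label β; so a pattern
      -- missing on `x ∷ Z` must have the opposite label at x.
      ... | yes refl = let (c , agree) , eq = sh s in c , cong₂ _∷_ (All.lookup agree z∈) eq
      ... | no b≢β with em {P = ∃ λ c → Vec.map (R c) (x ∷ Z) ≡ b ∷ s}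
      ...   | yes found = found
      ...   | no ¬found = ⊥-elim (¬forced (s , λ c eq → decidable-stable (R c x ≟ᵇ β) λ Rcx≢β →
                ¬found (c , cong₂ _∷_ (trans (¬-not Rcx≢β) (sym (¬-not b≢β))) eq)))

    trade : ∀ Z {γ} → Shattered {C = Restricted γ} (R ∘ proj₁) Z → length γ ≤ bound →
      ∃ λ s → Σ (List (Fin n × Bool)) λ γ′ → κ + length γ′ ≤ bound ×
        (∀ c → Agrees (R c) γ → Agrees (R c) γ′) ×
        (∀ c → Vec.map (R c) Z ≡ s → Agrees (R c) γ′ → Agrees (R c) γ)
    trade Z {γ} sh γ≤ with ≤-<-connex (length γ) (dual κ * κ)
    -- There is still room for the κ points of Z: nothing is dropped and any pattern s will do.
    ... | inj₁ short = Vec.replicate κ false , γ ,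
      ≤-trans (≤-reflexive (+-comm κ (length γ))) (+-monoˡ-≤ κ short) , (λ _ → id) , λ _ _ → id
    ... | inj₂ long =
      let s , short = pigeonhole κ κ γ long (All.tabulate (forcing-pattern Z sh))
          γ′ = filter (λ z → em {P = ¬ Forces Z s z}) γ
      in s , γ′ , ≤-trans (≤-reflexive (+-comm κ (length γ′))) (≤-trans short γ≤) ,
         (λ c → All.filter⁺ (λ z → em {P = ¬ Forces Z s z})) ,
         λ c eq agree → All.tabulate λ {z} z∈ → case em {P = Forces Z s z} of λ where
           (yes f) → f c eq
           (no ¬f) → All.lookup agree (∈-filter⁺ (λ z → em {P = ¬ Forces Z s z}) z∈ ¬f)

    -- Recursion on a bound for the number of patterns compatible with γ, while γ itself never
    -- outgrows `bound`. Once no κ-tuple is shattered, the remaining class is taught by the case of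
    -- smaller dimension.
    descend : ∀ fuel γ → length γ ≤ bound → Restricted γ → (L : List (Vec Bool n)) → length L ≤ fuel →
      (∀ c → Agrees (R c) γ → Vec.tabulate (R c) ∈ L) → TeachingSet R (bound + teachingSize κ)
    descend zero γ γ≤ (c , agree) [] _ cover = case cover c agree of λ ()
    descend (suc fuel) γ γ≤ c₀ L L≤ cover
      with em {P = Σ (Vec (Fin n) κ) λ Z → Shattered {C = Restricted γ} (R ∘ proj₁) Z}
    ... | no ¬sh =
      let γ′ , γ′≤ , (c , agree) , agree′ , unique =
            teach-smaller {C = Restricted γ} (R ∘ proj₁) (λ v sh → ¬sh (v , sh)) c₀
      in γ ++ γ′ , ≤-trans (≤-reflexive (length-++ γ)) (+-mono-≤ γ≤ γ′≤) , c , All.++⁺ agree agree′ ,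
         λ c′ both → unique (c′ , All.++⁻ˡ γ both) (All.++⁻ʳ γ both)
    ... | yes (Z , sh) =
      let s , γ′ , γ′≤ , weaker , stronger = trade Z sh γ≤
          (c₁ , agree₁) , eq₁ = sh s
          -- `c₂` agrees with γ but not with the new list, so its pattern leaves L. A second pattern
          -- on Z exists because κ is positive.
          (c₂ , agree₂) , eq₂ = sh (other s)
          old = Vec.tabulate (R c₂)
          keep = λ S → em {P = ¬ (S ≡ old)}
      in descend fuel (label Z s ++ γ′)
           (≤-trans (≤-reflexive (trans (length-++ (label Z s)) (cong (_+ length γ′) (length-label Z s)))) γ′≤)
           (c₁ , All.++⁺ (label⁺ (R c₁) Z eq₁) (weaker c₁ agree₁))
           (filter keep L)
           (≤-pred (≤-trans (filter-notAll keep L (lose (cover c₂ agree₂) λ ¬eq → ¬eq refl)) L≤))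
           λ c ag → let eq   = label⁻ (R c) Z s (All.++⁻ˡ (label Z s) ag)
                        rest = All.++⁻ʳ (label Z s) ag in
             ∈-filter⁺ keep (cover c (stronger c eq rest)) λ same →
               other-≢ s (trans (sym eq₂) (trans (map-cong⁺ (R c₂) (R c) (Allᵛ.universal (λ a → sym (tabulate-≡⁻ same a)) Z)) eq))
      where
      other : Vec Bool κ → Vec Bool κ
      other (b ∷ s) = not b ∷ s
      other-≢ : ∀ s → other s ≢ s
      other-≢ (b ∷ s) eq = not-¬ refl (sym (Vec.∷-injectiveˡ eq))

  teaching-set : ∀ k {n} {C : Set c} (R : C → Fin n → Bool) → (∀ (v : Vec (Fin n) k) → ¬ Shattered R v) →
                 C → TeachingSet R (teachingSize k)
  teaching-set zero R vc c = ⊥-elim (vc [] λ { [] → c , refl })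
  -- No single point is shattered, so all concepts coincide and the empty list teaches c.
  teaching-set (suc zero) R vc c = [] , z≤n , c , [] , λ c′ _ a → decidable-stable (R c′ a ≟ᵇ R c a) λ c′≢c →
    vc (a ∷ []) λ { (b ∷ []) → case b ≟ᵇ R c a of λ where
      (yes eq) → c , cong (_∷ []) (sym eq)
      (no ≢c)  → c′ , cong (_∷ []) (trans (¬-not c′≢c) (sym (¬-not ≢c))) }
  teaching-set (suc (suc k)) {n} R vc c =
    Descent.descend k R vc (teaching-set (suc k)) _ [] z≤n (c , []) (patterns n) ≤-refl λ c _ → ∈-patterns _

-- Variables, formulas and quantifier blocks

⇔-refl : A ⇔ A
⇔-refl = mk⇔ (λ x → x) (λ x → x)

⇔-sym : {A : Set a} {B : Set b} → A ⇔ B → B ⇔ A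
⇔-sym e = mk⇔ (from e) (to e)

infixr 4 _⇔-∙_
_⇔-∙_ : {A : Set a} {B : Set b} {C : Set c} → A ⇔ B → B ⇔ C → A ⇔ C
e ⇔-∙ f = mk⇔ (λ x → to f (to e x)) (λ x → from e (from f x))

⇔-≡ : {A B : Set a} → A ≡ B → A ⇔ B
⇔-≡ refl = ⇔-refl

_⇔-×_ : {A : Set a} {B : Set b} {C : Set c} {D : Set d} → A ⇔ B → C ⇔ D → (A × C) ⇔ (B × D)
e ⇔-× f = mk⇔ (λ (x , y) → to e x , to f y) (λ (x , y) → from e x , from f y)

_⇔-⊎_ : {A : Set a} {B : Set b} {C : Set c} {D : Set d} → A ⇔ B → C ⇔ D → (A ⊎ C) ⇔ (B ⊎ D)
e ⇔-⊎ f = mk⇔ (λ { (inj₁ x) → inj₁ (to e x) ; (inj₂ y) → inj₂ (to f y) })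
              (λ { (inj₁ x) → inj₁ (from e x) ; (inj₂ y) → inj₂ (from f y) })

_⇔-→_ : {A : Set a} {B : Set b} {C : Set c} {D : Set d} → A ⇔ B → C ⇔ D → (A → C) ⇔ (B → D)
e ⇔-→ f = mk⇔ (λ g x → to f (g (from e x))) (λ g x → from f (g (to e x)))

⇔-⇔ : {A : Set a} {B : Set b} {C : Set c} {D : Set d} → A ⇔ B → C ⇔ D → ((A → C) × (C → A)) ⇔ (B ⇔ D)
⇔-⇔ e f = mk⇔ (λ (g , h) → mk⇔ (λ x → to f (g (from e x))) (λ x → to e (h (from f x))))
              (λ i → (λ x → from f (to i (to e x))) , λ x → from e (from i (to f x)))

⇔-Π : {A : Set a} {B : A → Set b} {C : A → Set c} → (∀ x → B x ⇔ C x) → (∀ x → B x) ⇔ (∀ x → C x)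
⇔-Π e = mk⇔ (λ g x → to (e x) (g x)) (λ g x → from (e x) (g x))

⇔-Σ : {A : Set a} {B : A → Set b} {C : A → Set c} → (∀ x → B x ⇔ C x) → Σ A B ⇔ Σ A C
⇔-Σ e = mk⇔ (λ (x , y) → x , to (e x) y) (λ (x , y) → x , from (e x) y)

module _ {S : Set a} {P : S → Set b} {Q : S → Set c} (f : ∀ {s} → P s → Q s) where

  map-++⁺ : ∀ {Δ Θ : List S} (u : All P Δ) (v : All P Θ) → All.map f (++⁺ u v) ≡ ++⁺ (All.map f u) (All.map f v)
  map-++⁺ []      v = refl
  map-++⁺ (m ∷ u) v = cong (f m ∷_) (map-++⁺ u v)

  map-++⁻ˡ : ∀ Δ {Θ : List S} (w : All P (Δ ++ Θ)) → All.map f (++⁻ˡ Δ w) ≡ ++⁻ˡ Δ (All.map f w)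
  map-++⁻ˡ []      w       = refl
  map-++⁻ˡ (s ∷ Δ) (m ∷ w) = cong (f m ∷_) (map-++⁻ˡ Δ w)

  map-++⁻ʳ : ∀ Δ {Θ : List S} (w : All P (Δ ++ Θ)) → All.map f (++⁻ʳ Δ w) ≡ ++⁻ʳ Δ (All.map f w)
  map-++⁻ʳ []      w       = refl
  map-++⁻ʳ (s ∷ Δ) (m ∷ w) = map-++⁻ʳ Δ w

-- A tuple of variables. Being an `All`, it shares `++⁺` and `act` with tuples of elements; it takes
-- valuations of Γ to valuations of Δ, whence the direction of `ren`.
Sel : {S : Set a} → List S → List S → Set a
Sel Γ Δ = All (_∈ Γ) Δ

module _ {S : Set a} {P : S → Set b} where

  -- With P = (_∈ Θ) this is the composition of substitutions of variables for variables.
  act : ∀ {Γ Δ : List S} → All P Γ → Sel Γ Δ → All P Δ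
  act v = All.map (All.lookup v)

  act-there : ∀ {Γ Δ s} {m : P s} {v : All P Γ} (ρ : Sel Γ Δ) → act (m ∷ v) (All.map there ρ) ≡ act v ρ
  act-there []      = refl
  act-there (i ∷ ρ) = cong (_ ∷_) (act-there ρ)

  act-act : ∀ {Γ Δ Θ} (v : All P Γ) (τ : Sel Γ Δ) (ρ : Sel Δ Θ) →
            All.map (All.lookup v) (All.map (All.lookup τ) ρ) ≡ act (act v τ) ρ
  act-act v τ []      = refl
  act-act v τ (i ∷ ρ) = cong₂ _∷_ (sym (All.lookup-map τ i)) (act-act v τ ρ)

  ++⁻ˡ-++⁺ : ∀ {Γ Δ} (u : All P Δ) (v : All P Γ) → ++⁻ˡ Δ (++⁺ u v) ≡ u
  ++⁻ˡ-++⁺ []      v = refl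
  ++⁻ˡ-++⁺ (x ∷ u) v = cong (x ∷_) (++⁻ˡ-++⁺ u v)

  ++⁻ʳ-++⁺ : ∀ {Γ Δ} (u : All P Δ) (v : All P Γ) → ++⁻ʳ Δ (++⁺ u v) ≡ v
  ++⁻ʳ-++⁺ []      v = refl
  ++⁻ʳ-++⁺ (x ∷ u) v = ++⁻ʳ-++⁺ u v

  ++⁺-++⁻ : ∀ Δ {Γ} (w : All P (Δ ++ Γ)) → ++⁺ (++⁻ˡ Δ w) (++⁻ʳ Δ w) ≡ w
  ++⁺-++⁻ []      w       = refl
  ++⁺-++⁻ (s ∷ Δ) (m ∷ w) = cong (m ∷_) (++⁺-++⁻ Δ w)

ids : {S : Set a} {Γ : List S} → Sel Γ Γ
ids {Γ = []}    = []
ids {Γ = s ∷ Γ} = here refl ∷ All.map there ids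

lifted : {S : Set a} {Γ Δ : List S} {s : S} → Sel Γ Δ → Sel (s ∷ Γ) (s ∷ Δ)
lifted ρ = here refl ∷ All.map there ρ

bound : {S : Set a} (Δ : List S) {Γ : List S} → Sel (Δ ++ Γ) Δ
bound Δ = ++⁻ˡ Δ ids

free : {S : Set a} (Δ : List S) {Γ : List S} → Sel (Δ ++ Γ) Γ
free Δ = ++⁻ʳ Δ ids

weaken : {S : Set a} (Δ : List S) {Γ Θ : List S} → Sel Γ Θ → Sel (Δ ++ Γ) Θ
weaken Δ = act (free Δ)

module _ {S : Set a} {P : S → Set b} where

  act-ids : ∀ {Γ} (v : All P Γ) → act v ids ≡ v
  act-ids []      = refl
  act-ids (m ∷ v) = cong (m ∷_) (trans (act-there ids) (act-ids v))

  act-bound : ∀ {Γ Δ} (u : All P Δ) (v : All P Γ) → act (++⁺ u v) (bound Δ) ≡ u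
  act-bound {Δ = Δ} u v = trans (map-++⁻ˡ (All.lookup (++⁺ u v)) Δ ids) (trans (cong (++⁻ˡ Δ) (act-ids (++⁺ u v))) (++⁻ˡ-++⁺ u v))

  act-free : ∀ {Γ Δ} (u : All P Δ) (v : All P Γ) → act (++⁺ u v) (free Δ) ≡ v
  act-free {Δ = Δ} u v = trans (map-++⁻ʳ (All.lookup (++⁺ u v)) Δ ids) (trans (cong (++⁻ʳ Δ) (act-ids (++⁺ u v))) (++⁻ʳ-++⁺ u v))

  act-weaken : ∀ {Γ Δ Θ} (u : All P Δ) (v : All P Γ) (ρ : Sel Γ Θ) → act (++⁺ u v) (weaken Δ ρ) ≡ act v ρ
  act-weaken {Δ = Δ} u v ρ = trans (act-act (++⁺ u v) (free Δ) ρ) (cong (λ w → act w ρ) (act-free u v))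

module _ {ℓ : Level} {L : Language ℓ} where
  open Language L
  open Structure

  -- `tuple` over an arbitrary family, so that it serves tuples of variables as well as tuples of
  -- elements.
  block : {P : Sort → Set a} {x : Ctx L} {n : ℕ} → Vec (All P x) n → All P (copies {L = L} n x)
  block []      = []
  block (e ∷ es) = ++⁺ e (block es)

  unblock : {P : Sort → Set a} {x : Ctx L} (n : ℕ) → All P (copies {L = L} n x) → Vec (All P x) n
  unblock zero          _ = []
  unblock {x = x} (suc n) w = ++⁻ˡ x w ∷ unblock n (++⁻ʳ x w)

  unblock-block : {P : Sort → Set a} {x : Ctx L} {n : ℕ} (es : Vec (All P x) n) → unblock n (block es) ≡ es
  unblock-block []       = refl
  unblock-block (e ∷ es) = cong₂ _∷_ (++⁻ˡ-++⁺ e (block es))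
    (trans (cong (unblock _) (++⁻ʳ-++⁺ e (block es))) (unblock-block es))

  block-unblock : {P : Sort → Set a} {x : Ctx L} (n : ℕ) (w : All P (copies {L = L} n x)) → block (unblock n w) ≡ w
  block-unblock zero    []  = refl
  block-unblock {x = x} (suc n) w =
    trans (cong (++⁺ (++⁻ˡ x w)) (block-unblock n (++⁻ʳ x w))) (++⁺-++⁻ x w)

  tuple≡block : (M : Structure L) {x : Ctx L} {n : ℕ} (es : Vec (M ^ x) n) → tuple M es ≡ block es
  tuple≡block M []       = refl
  tuple≡block M (e ∷ es) = cong (++⁺ e) (tuple≡block M es)

  map-block : {P : Sort → Set a} {Q : Sort → Set b} (f : ∀ {s} → P s → Q s) {x : Ctx L} {n : ℕ}
              (es : Vec (All P x) n) → All.map f (block es) ≡ block (Vec.map (All.map f) es)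
  map-block f []       = refl
  map-block f (e ∷ es) = trans (map-++⁺ f e (block es)) (cong (++⁺ (All.map f e)) (map-block f es))

  map-unblock : {P : Sort → Set a} {Q : Sort → Set b} (f : ∀ {s} → P s → Q s) {x : Ctx L} (n : ℕ)
                (w : All P (copies {L = L} n x)) → Vec.map (All.map f) (unblock n w) ≡ unblock n (All.map f w)
  map-unblock f zero    w = refl
  map-unblock f {x} (suc n) w = cong₂ _∷_ (map-++⁻ˡ f x w)
    (trans (map-unblock f n (++⁻ʳ x w)) (cong (unblock n) (map-++⁻ʳ f x w)))

  mutual
    renᵗ : ∀ {Γ Δ s} → Sel Γ Δ → Term L Δ s → Term L Γ s
    renᵗ ρ (var i)    = var (All.lookup ρ i)
    renᵗ ρ (app f ts) = app f (renᵗˢ ρ ts)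

    renᵗˢ : ∀ {Γ Δ ss} → Sel Γ Δ → All (Term L Δ) ss → All (Term L Γ) ss
    renᵗˢ ρ []       = []
    renᵗˢ ρ (t ∷ ts) = renᵗ ρ t ∷ renᵗˢ ρ ts

  ren : ∀ {Γ Δ} → Sel Γ Δ → Formula L Δ → Formula L Γ
  ren ρ ⊥ᶠ         = ⊥ᶠ
  ren ρ (t ≈ᶠ u)   = renᵗ ρ t ≈ᶠ renᵗ ρ u
  ren ρ (rel R ts) = rel R (renᵗˢ ρ ts)
  ren ρ (χ ∧ᶠ ω)   = ren ρ χ ∧ᶠ ren ρ ω
  ren ρ (χ ∨ᶠ ω)   = ren ρ χ ∨ᶠ ren ρ ω
  ren ρ (χ ⇒ᶠ ω)   = ren ρ χ ⇒ᶠ ren ρ ω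
  ren ρ (∀ᶠ s χ)   = ∀ᶠ s (ren (lifted ρ) χ)
  ren ρ (∃ᶠ s χ)   = ∃ᶠ s (ren (lifted ρ) χ)

  module _ (M : Structure L) where

    mutual
      eval-renᵗ : ∀ {Γ Δ s} (v : M ^ Γ) (ρ : Sel Γ Δ) (t : Term L Δ s) →
                  evalᵗ M v (renᵗ ρ t) ≡ evalᵗ M (act v ρ) t
      eval-renᵗ v ρ (var i)    = sym (All.lookup-map ρ i)
      eval-renᵗ v ρ (app f ts) = cong (⟦ M ⟧ᶠ f) (eval-renᵗˢ v ρ ts)

      eval-renᵗˢ : ∀ {Γ Δ ss} (v : M ^ Γ) (ρ : Sel Γ Δ) (ts : All (Term L Δ) ss) →
                   evalᵗˢ M v (renᵗˢ ρ ts) ≡ evalᵗˢ M (act v ρ) ts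
      eval-renᵗˢ v ρ []       = refl
      eval-renᵗˢ v ρ (t ∷ ts) = cong₂ _∷_ (eval-renᵗ v ρ t) (eval-renᵗˢ v ρ ts)

    ⊨-cong : ∀ {Γ} (χ : Formula L Γ) {v w : M ^ Γ} → v ≡ w → M ⊨ χ [ v ] ⇔ M ⊨ χ [ w ]
    ⊨-cong χ refl = ⇔-refl

    ⊨-ren : ∀ {Γ Δ} (χ : Formula L Δ) (v : M ^ Γ) (ρ : Sel Γ Δ) → M ⊨ ren ρ χ [ v ] ⇔ M ⊨ χ [ act v ρ ]
    ⊨-ren ⊥ᶠ         v ρ = ⇔-refl
    ⊨-ren (t ≈ᶠ u)   v ρ = ⇔-≡ (cong₂ _≡_ (eval-renᵗ v ρ t) (eval-renᵗ v ρ u))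
    ⊨-ren (rel R ts) v ρ = ⇔-≡ (cong (⟦ M ⟧ʳ R) (eval-renᵗˢ v ρ ts))
    ⊨-ren (χ ∧ᶠ ω)   v ρ = ⊨-ren χ v ρ ⇔-× ⊨-ren ω v ρ
    ⊨-ren (χ ∨ᶠ ω)   v ρ = ⊨-ren χ v ρ ⇔-⊎ ⊨-ren ω v ρ
    ⊨-ren (χ ⇒ᶠ ω)   v ρ = ⊨-ren χ v ρ ⇔-→ ⊨-ren ω v ρ
    ⊨-ren (∀ᶠ s χ)   v ρ = ⇔-Π λ m → ⊨-ren χ (m ∷ v) (lifted ρ) ⇔-∙ ⊨-cong χ (cong (m ∷_) (act-there ρ))
    ⊨-ren (∃ᶠ s χ)   v ρ = ⇔-Σ λ m → ⊨-ren χ (m ∷ v) (lifted ρ) ⇔-∙ ⊨-cong χ (cong (m ∷_) (act-there ρ))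

  ⊤ᶠ : ∀ {Γ} → Formula L Γ
  ⊤ᶠ = ⊥ᶠ ⇒ᶠ ⊥ᶠ

  infix 40 _⇔ᶠ_
  _⇔ᶠ_ : ∀ {Γ} → Formula L Γ → Formula L Γ → Formula L Γ
  χ ⇔ᶠ ω = (χ ⇒ᶠ ω) ∧ᶠ (ω ⇒ᶠ χ)

  _≈*_ : ∀ {Γ Δ} → Sel Γ Δ → Sel Γ Δ → Formula L Γ
  []      ≈* []      = ⊤ᶠ
  (i ∷ ρ) ≈* (j ∷ τ) = (var i ≈ᶠ var j) ∧ᶠ (ρ ≈* τ)

  ∀* ∃* : ∀ Δ {Γ} → Formula L (Δ ++ Γ) → Formula L Γ
  ∀* []      χ = χ
  ∀* (s ∷ Δ) χ = ∀* Δ (∀ᶠ s χ)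
  ∃* []      χ = χ
  ∃* (s ∷ Δ) χ = ∃* Δ (∃ᶠ s χ)

  _at_,_ : ∀ {Γ x y} → Formula L (x ++ y) → Sel Γ x → Sel Γ y → Formula L Γ
  χ at ξ , υ = ren (++⁺ ξ υ) χ

  module _ (M : Structure L) where

    ⊨-≈* : ∀ {Γ Δ} (v : M ^ Γ) (ρ τ : Sel Γ Δ) → M ⊨ ρ ≈* τ [ v ] ⇔ act v ρ ≡ act v τ
    ⊨-≈* v []      []      = mk⇔ (λ _ → refl) (λ _ x → x)
    ⊨-≈* v (i ∷ ρ) (j ∷ τ) = mk⇔
      (λ (e , es) → cong₂ _∷_ e (to (⊨-≈* v ρ τ) es))
      (λ eq → cong All.head eq , from (⊨-≈* v ρ τ) (cong All.tail eq))

    ⊨-∀* : ∀ Δ {Γ} (χ : Formula L (Δ ++ Γ)) (v : M ^ Γ) → M ⊨ ∀* Δ χ [ v ] ⇔ (∀ u → M ⊨ χ [ ++⁺ u v ])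
    ⊨-∀* []      χ v = mk⇔ (λ { h [] → h }) (λ h → h [])
    ⊨-∀* (s ∷ Δ) χ v = ⊨-∀* Δ (∀ᶠ s χ) v ⇔-∙ mk⇔ (λ { h (m ∷ u) → h u m }) (λ h u m → h (m ∷ u))

    ⊨-∃* : ∀ Δ {Γ} (χ : Formula L (Δ ++ Γ)) (v : M ^ Γ) → M ⊨ ∃* Δ χ [ v ] ⇔ Σ (M ^ Δ) λ u → M ⊨ χ [ ++⁺ u v ]
    ⊨-∃* []      χ v = mk⇔ (λ h → [] , h) (λ { ([] , h) → h })
    ⊨-∃* (s ∷ Δ) χ v = ⊨-∃* Δ (∃ᶠ s χ) v ⇔-∙ mk⇔ (λ (u , m , h) → m ∷ u , h) (λ { (m ∷ u , h) → u , m , h })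

    ⊨-at : ∀ {Γ x y} (χ : Formula L (x ++ y)) (v : M ^ Γ) (ξ : Sel Γ x) (υ : Sel Γ y) {p : M ^ x} {q : M ^ y} →
           act v ξ ≡ p → act v υ ≡ q → M ⊨ χ at ξ , υ [ v ] ⇔ M ⊨ χ [ ++⁺ p q ]
    ⊨-at χ v ξ υ refl refl = ⊨-ren M χ v (++⁺ ξ υ) ⇔-∙ ⊨-cong M χ (map-++⁺ (All.lookup v) ξ υ)


-- Formulas of the language with P and Q

module _ {ℓ : Level} {L : Language ℓ} {x : Ctx L} where
  open Structure

  mutual
    oldᵗ : ∀ {Γ s} → Term L Γ s → Term (LanguagePQ L x) Γ s
    oldᵗ (var i)    = var i
    oldᵗ (app f ts) = app f (oldᵗˢ ts)

    oldᵗˢ : ∀ {Γ ss} → All (Term L Γ) ss → All (Term (LanguagePQ L x) Γ) ss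
    oldᵗˢ []       = []
    oldᵗˢ (t ∷ ts) = oldᵗ t ∷ oldᵗˢ ts

  oldᶠ : ∀ {Γ} → Formula L Γ → Formula (LanguagePQ L x) Γ
  oldᶠ ⊥ᶠ         = ⊥ᶠ
  oldᶠ (t ≈ᶠ u)   = oldᵗ t ≈ᶠ oldᵗ u
  oldᶠ (rel R ts) = rel (old R) (oldᵗˢ ts)
  oldᶠ (χ ∧ᶠ ω)   = oldᶠ χ ∧ᶠ oldᶠ ω
  oldᶠ (χ ∨ᶠ ω)   = oldᶠ χ ∨ᶠ oldᶠ ω
  oldᶠ (χ ⇒ᶠ ω)   = oldᶠ χ ⇒ᶠ oldᶠ ω
  oldᶠ (∀ᶠ s χ)   = ∀ᶠ s (oldᶠ χ)
  oldᶠ (∃ᶠ s χ)   = ∃ᶠ s (oldᶠ χ)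

  atom : ∀ {Γ} → RelPQ L x x → Sel Γ x → Formula (LanguagePQ L x) Γ
  atom R ξ = rel R (All.map var ξ)

  reduct : Structure (LanguagePQ L x) → Structure L
  reduct N = record
    { Carrier  = Carrier N
    ; nonempty = nonempty N
    ; ⟦_⟧ᶠ     = ⟦ N ⟧ᶠ
    ; ⟦_⟧ʳ     = λ R → ⟦ N ⟧ʳ (old R)
    }

  module _ (N : Structure (LanguagePQ L x)) where

    mutual
      eval-oldᵗ : ∀ {Γ s} (v : N ^ Γ) (t : Term L Γ s) → evalᵗ N v (oldᵗ t) ≡ evalᵗ (reduct N) v t
      eval-oldᵗ v (var i)    = refl
      eval-oldᵗ v (app f ts) = cong (⟦ N ⟧ᶠ f) (eval-oldᵗˢ v ts)

      eval-oldᵗˢ : ∀ {Γ ss} (v : N ^ Γ) (ts : All (Term L Γ) ss) → evalᵗˢ N v (oldᵗˢ ts) ≡ evalᵗˢ (reduct N) v ts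
      eval-oldᵗˢ v []       = refl
      eval-oldᵗˢ v (t ∷ ts) = cong₂ _∷_ (eval-oldᵗ v t) (eval-oldᵗˢ v ts)

    ⊨-old : ∀ {Γ} (χ : Formula L Γ) (v : N ^ Γ) → N ⊨ oldᶠ χ [ v ] ⇔ reduct N ⊨ χ [ v ]
    ⊨-old ⊥ᶠ         v = ⇔-refl
    ⊨-old (t ≈ᶠ u)   v = ⇔-≡ (cong₂ _≡_ (eval-oldᵗ v t) (eval-oldᵗ v u))
    ⊨-old (rel R ts) v = ⇔-≡ (cong (⟦ N ⟧ʳ (old R)) (eval-oldᵗˢ v ts))
    ⊨-old (χ ∧ᶠ ω)   v = ⊨-old χ v ⇔-× ⊨-old ω v
    ⊨-old (χ ∨ᶠ ω)   v = ⊨-old χ v ⇔-⊎ ⊨-old ω v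
    ⊨-old (χ ⇒ᶠ ω)   v = ⊨-old χ v ⇔-→ ⊨-old ω v
    ⊨-old (∀ᶠ s χ)   v = ⇔-Π λ m → ⊨-old χ (m ∷ v)
    ⊨-old (∃ᶠ s χ)   v = ⇔-Σ λ m → ⊨-old χ (m ∷ v)

    ⊨-atom : ∀ {Γ} (R : RelPQ L x x) (v : N ^ Γ) (ξ : Sel Γ x) → N ⊨ atom R ξ [ v ] ⇔ ⟦ N ⟧ʳ R (act v ξ)
    ⊨-atom R v ξ = ⇔-≡ (cong (⟦ N ⟧ʳ R) (vars ξ))
      where
      vars : ∀ {Δ} (ξ : Sel _ Δ) → evalᵗˢ N v (All.map var ξ) ≡ act v ξ
      vars []      = refl
      vars (i ∷ ξ) = cong (_ ∷_) (vars ξ)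

-- A leaf of a decision tree is a pair of parameters, meaning true when they differ.
module Trees (w : ℕ) where

  treeSize : ℕ → ℕ
  treeSize zero    = 2
  treeSize (suc t) = w + (treeSize t + treeSize t)

  test : ∀ t → Vec A (treeSize (suc t)) → Vec A w
  test t es = Vec.take w es

  branch : ∀ t → Bool → Vec A (treeSize (suc t)) → Vec A (treeSize t)
  branch t true  es = Vec.take (treeSize t) (Vec.drop w es)
  branch t false es = Vec.drop (treeSize t) (Vec.drop w es)

  map-test : (f : A → B) → ∀ t es → Vec.map f (test t es) ≡ test t (Vec.map f es)
  map-test f t es = sym (Vec.take-map f w es)

  map-branch : (f : A → B) → ∀ t s es → Vec.map f (branch t s es) ≡ branch t s (Vec.map f es)
  map-branch f t true  es = sym (trans (cong (Vec.take (treeSize t)) (Vec.drop-map f w es))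
                                       (Vec.take-map f (treeSize t) (Vec.drop w es)))
  map-branch f t false es = sym (trans (cong (Vec.drop (treeSize t)) (Vec.drop-map f w es))
                                       (Vec.drop-map f (treeSize t) (Vec.drop w es)))

  module _ (a₀ a₁ : A) where

    -- All nodes of one level carry the same test, so the leaves form the truth table of F and every
    -- Boolean function of the t results can be stored.
    encode : ∀ t → Vec (Vec A w) t → (Vec Bool t → Bool) → Vec A (treeSize t)
    encode zero    []       F = a₀ ∷ (if F [] then a₁ else a₀) ∷ []
    encode (suc t) (h ∷ hs) F = h Vec.++ (encode t hs (F ∘ (true ∷_)) Vec.++ encode t hs (F ∘ (false ∷_)))

    All-encode : {P : A → Set b} → P a₀ → P a₁ → ∀ t {hs} F → Allᵛ (Allᵛ P) hs → Allᵛ P (encode t hs F)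
    All-encode p₀ p₁ zero    F []       with F []
    ... | true  = p₀ ∷ p₁ ∷ []
    ... | false = p₀ ∷ p₀ ∷ []
    All-encode p₀ p₁ (suc t) F (h ∷ hs) =
      Allᵛ.++⁺ h (Allᵛ.++⁺ (All-encode p₀ p₁ t _ hs) (All-encode p₀ p₁ t _ hs))

    test-encode : ∀ t h hs F → test t (encode (suc t) (h ∷ hs) F) ≡ h
    test-encode t h hs F = Vec.++-injectiveˡ (Vec.take w all) h (Vec.take++drop≡id w all)
      where all = encode (suc t) (h ∷ hs) F

    branch-encode : ∀ t s h hs F → branch t s (encode (suc t) (h ∷ hs) F) ≡ encode t hs (F ∘ (s ∷_))
    branch-encode t s h hs F = rest s
      where
      all = encode (suc t) (h ∷ hs) F
      dropped : Vec.drop w all ≡ encode t hs (F ∘ (true ∷_)) Vec.++ encode t hs (F ∘ (false ∷_))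
      dropped = Vec.++-injectiveʳ (Vec.take w all) h (Vec.take++drop≡id w all)
      rest : ∀ s → branch t s all ≡ encode t hs (F ∘ (s ∷_))
      rest true  = Vec.++-injectiveˡ (Vec.take (treeSize t) (Vec.drop w all)) (encode t hs (F ∘ (true ∷_)))
                     (trans (Vec.take++drop≡id (treeSize t) (Vec.drop w all)) dropped)
      rest false = Vec.++-injectiveʳ (Vec.take (treeSize t) (Vec.drop w all)) (encode t hs (F ∘ (true ∷_)))
                     (trans (Vec.take++drop≡id (treeSize t) (Vec.drop w all)) dropped)

  module Semantics {ℓ} {A : Set ℓ} (H : A → Vec A w → Set ℓ) where

    Tree : ∀ t → A → Vec A (treeSize t) → Set ℓ
    Tree zero    a (u ∷ u′ ∷ []) = u ≡ u′ → Lift ℓ ⊥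
    Tree (suc t) a es = (H a (test t es) × Tree t a (branch t true es)) ⊎
                        ((H a (test t es) → Lift ℓ ⊥) × Tree t a (branch t false es))

    module _ (em : ∀ {a} → ExcludedMiddle a) where
      open Classical em

      Tree-if : ∀ t a es → Tree (suc t) a es ⇔ Tree t a (branch t (truth (H a (test t es))) es)
      Tree-if t a es with em {P = H a (test t es)}
      ... | yes h = mk⇔ (λ { (inj₁ (_ , T)) → T ; (inj₂ (¬h , _)) → ⊥-elim (Level.lower (¬h h)) }) (λ T → inj₁ (h , T))
      ... | no ¬h = mk⇔ (λ { (inj₁ (h , _)) → ⊥-elim (¬h h) ; (inj₂ (_ , T)) → T }) (λ T → inj₂ ((λ h → lift (¬h h)) , T))

      Tree-encode : ∀ {a₀ a₁} → a₀ ≢ a₁ → ∀ t a hs F →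
        Tree t a (encode a₀ a₁ t hs F) ⇔ F (Vec.map (λ h → truth (H a h)) hs) ≡ true
      Tree-encode a₀≢a₁ zero    a []       F with F []
      ... | true  = mk⇔ (λ _ → refl) (λ _ eq → lift (a₀≢a₁ eq))
      ... | false = mk⇔ (λ ne → ⊥-elim (Level.lower (ne refl))) (λ ())
      Tree-encode {a₀} {a₁} a₀≢a₁ (suc t) a (h ∷ hs) F =
        Tree-if t a es ⇔-∙
        ⇔-≡ (cong (λ u → Tree t a (branch t (truth (H a u)) es)) (test-encode a₀ a₁ t h hs F)) ⇔-∙
        ⇔-≡ (cong (Tree t a) (branch-encode a₀ a₁ t (truth (H a h)) h hs F)) ⇔-∙
        Tree-encode a₀≢a₁ t a hs (F ∘ (truth (H a h) ∷_))
        where es = encode a₀ a₁ (suc t) (h ∷ hs) F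

-- VC-dimension as a sentence, selectors, and the formula of a decision tree

module Definability (em : ∀ {a} → ExcludedMiddle a) {ℓ : Level} {L : Language ℓ} (x y : Ctx L) (φ : Formula L (x ++ y)) where
  open Classical em
  open Boosting em
  open Structure

  R : (M : Structure L) → M ^ y → M ^ x → Bool
  R M b a = truth (M ⊨ φ [ ++⁺ a b ])

  VC : Structure L → ℕ → Set ℓ
  VC M k = ∀ (v : Vec (M ^ x) k) → ¬ Shattered (R M) v

  conj : ∀ {L : Language ℓ} {Γ} → List A → (A → Formula L Γ) → Formula L Γ
  conj []       f = ⊤ᶠ
  conj (z ∷ zs) f = f z ∧ᶠ conj zs f

  ⊨-conj : ∀ {L : Language ℓ} (M : Structure L) {Γ} (v : M ^ Γ) (zs : List A) (f : A → Formula L Γ) →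
           M ⊨ conj zs f [ v ] ⇔ All (λ z → M ⊨ f z [ v ]) zs
  ⊨-conj M v []       f = mk⇔ (λ _ → []) (λ _ z → z)
  ⊨-conj M v (z ∷ zs) f = (⇔-refl ⇔-× ⊨-conj M v zs f) ⇔-∙ mk⇔ (λ (p , ps) → p ∷ ps) (λ { (p ∷ ps) → p , ps })

  conjᵛ : ∀ {L : Language ℓ} {Γ m} → Vec A m → (A → Formula L Γ) → Formula L Γ
  conjᵛ []       f = ⊤ᶠ
  conjᵛ (z ∷ zs) f = f z ∧ᶠ conjᵛ zs f

  ⊨-conjᵛ : ∀ {L : Language ℓ} (M : Structure L) {Γ m} (v : M ^ Γ) (zs : Vec A m) (f : A → Formula L Γ)
            {B : Set b} {g : A → B} {P : B → Set c} → (∀ z → M ⊨ f z [ v ] ⇔ P (g z)) →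
            M ⊨ conjᵛ zs f [ v ] ⇔ Allᵛ P (Vec.map g zs)
  ⊨-conjᵛ M v []       f e = mk⇔ (λ _ → []) (λ _ z → z)
  ⊨-conjᵛ M v (z ∷ zs) f e = (e z ⇔-× ⊨-conjᵛ M v zs f e) ⇔-∙ mk⇔ (λ (p , ps) → p ∷ ps) (λ { (p ∷ ps) → p , ps })

  ⊨-^ᶠ : (M : Structure L) → ∀ {Γ} (χ : Formula L Γ) (v : M ^ Γ) s → M ⊨ χ ^ᶠ s [ v ] ⇔ truth (M ⊨ χ [ v ]) ≡ s
  ⊨-^ᶠ M χ v true  = mk⇔ truth⁺ truth⁻
  ⊨-^ᶠ M χ v false = mk⇔ (λ ¬h → truth-false⁺ (Level.lower ∘ ¬h)) (λ eq h → lift (truth-false⁻ eq h))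

  lits : ∀ {Γ m} → Vec (Sel Γ x) m → Vec Bool m → Sel Γ y → Formula L Γ
  lits []       []      υ = ⊤ᶠ
  lits (ξ ∷ ξs) (s ∷ S) υ = ((φ at ξ , υ) ^ᶠ s) ∧ᶠ lits ξs S υ

  realises : ∀ {m} → Vec Bool m → Formula L (copies {L = L} m x)
  realises {m} S = ∃* y (lits (unblock m (free y)) S (bound y))

  not-shattered : ℕ → Sentence L
  not-shattered k = ∃* (copies {L = L} k x) (conj (patterns k) (λ S → ren (bound (copies {L = L} k x)) (realises S))) ⇒ᶠ ⊥ᶠ

  module _ (M : Structure L) where

    ⊨-lits : ∀ {Γ m} (v : M ^ Γ) (ξs : Vec (Sel Γ x) m) S (υ : Sel Γ y) →
             M ⊨ lits ξs S υ [ v ] ⇔ Vec.map (R M (act v υ)) (Vec.map (act v) ξs) ≡ S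
    ⊨-lits v []       []      υ = mk⇔ (λ _ → refl) (λ _ z → z)
    ⊨-lits v (ξ ∷ ξs) (s ∷ S) υ =
      ((⊨-^ᶠ M (φ at ξ , υ) v s ⇔-∙ ⇔-≡ (cong (_≡ s) (truth-cong (⊨-at M φ v ξ υ refl refl)))) ⇔-× ⊨-lits v ξs S υ) ⇔-∙
      mk⇔ (λ (e , es) → cong₂ _∷_ e es) (λ eq → Vec.∷-injectiveˡ eq , Vec.∷-injectiveʳ eq)

    ⊨-realises : ∀ {m} (S : Vec Bool m) (w : M ^ copies m x) →
                 M ⊨ realises S [ w ] ⇔ ∃ λ b → Vec.map (R M b) (unblock m w) ≡ S
    ⊨-realises {m} S w = ⊨-∃* M y _ w ⇔-∙ ⇔-Σ λ b →
      ⊨-lits (++⁺ b w) (unblock m (free y)) S (bound y) ⇔-∙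
      ⇔-≡ (cong₂ (λ b ws → Vec.map (R M b) ws ≡ S) (act-bound b w)
                 (trans (map-unblock _ m (free y)) (cong (unblock m) (act-free b w))))

    ⊨-not-shattered : ∀ k → M ⊨ not-shattered k ⇔ VC M k
    ⊨-not-shattered k =
      ((⊨-∃* M Δ _ [] ⇔-∙ ⇔-Σ λ w →
        ⊨-conj M (++⁺ w []) (patterns k) _ ⇔-∙
        mk⇔ (λ all S → to (realised w S) (All.lookup all (∈-patterns S)))
            (λ sh → All.tabulate (λ {S} _ → from (realised w S) (sh S)))) ⇔-→ ⇔-refl {A = Lift ℓ ⊥}) ⇔-∙
      mk⇔ (λ none v sh → Level.lower (none (block v , subst (Shattered (R M)) (sym (unblock-block v)) sh)))
          (λ none (w , sh) → lift (none (unblock k w) sh))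
      where
      Δ = copies {L = L} k x
      realised : ∀ w S → M ⊨ ren (bound Δ) (realises S) [ ++⁺ w [] ] ⇔ Trace (R M) (unblock k w) S
      realised w S = ⊨-ren M (realises S) (++⁺ w []) (bound Δ) ⇔-∙
        ⊨-cong M (realises S) (act-bound w []) ⇔-∙ ⊨-realises S w

  Injective-Shatters : (M : Structure L) {k : ℕ} (v : Vec (M ^ x) k) → Shattered (R M) v →
    Injective _≡_ _≡_ (Vec.lookup v) × Shatters (λ b a → M ⊨ φ [ ++⁺ a b ]) (Vec.lookup v)
  Injective-Shatters M {k} v sh = injective , λ S → let b , eq = sh S in b , λ i → member b S eq i
    where
    value : ∀ {b S} → Vec.map (R M b) v ≡ S → ∀ i → R M b (Vec.lookup v i) ≡ Vec.lookup S i
    value {b} eq i = trans (sym (Vec.lookup-map i (R M b) v)) (cong (λ T → Vec.lookup T i) eq)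
    member : ∀ b S → Vec.map (R M b) v ≡ S → ∀ i → M ⊨ φ [ ++⁺ (Vec.lookup v i) b ] ⇔ i ∈ˢ S
    member b S eq i = mk⇔
      (λ h → Vec.lookup⇒[]= i S (trans (sym (value eq i)) (truth⁺ h)))
      (λ i∈ → truth⁻ (trans (value eq i) (Vec.[]=⇒lookup i∈)))
    injective : Injective _≡_ _≡_ (Vec.lookup v)
    injective {i} {j} eq =
      -- The pattern that is true at i alone tells i from every other index.
      let S = Vec.tabulate (λ l → does (i ≟ᶠ l))
          b , tr = sh S
          at-j = trans (sym (Vec.lookup∘tabulate (λ l → does (i ≟ᶠ l)) j)) (trans (sym (value tr j))
                   (trans (cong (R M b) (sym eq)) (trans (value tr i)
                     (trans (Vec.lookup∘tabulate (λ l → does (i ≟ᶠ l)) i) (dec-true (i ≟ᶠ i) refl)))))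
      in decidable-stable (i ≟ᶠ j) λ i≢j → case trans (sym at-j) (dec-false (i ≟ᶠ j) i≢j) of λ ()

  FiniteVC⇒VC : (M : Structure L) ((d , _) : FiniteVC (λ (b : M ^ y) (a : M ^ x) → M ⊨ φ [ ++⁺ a b ])) → VC M (suc d)
  FiniteVC⇒VC M (d , small) v sh = let inj , shatters = Injective-Shatters M v sh in <-irrefl refl (small (Vec.lookup v) inj shatters)

  -- Non-shattering of k-tuples is a sentence, so completeness of T carries it, with the same k,
  -- from the one given model to all models.
  NIP⇒VC : ∀ {T : Theory L} → Complete T → NIP T x y φ → ∃ λ k → ∀ M → M ⊨ᵀ T → VC M k
  NIP⇒VC {T} (_ , decide) (M₀ , M₀⊨T , vc) = k , everywhere
    where
    k = suc (proj₁ vc)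
    everywhere : ∀ M → M ⊨ᵀ T → VC M k
    everywhere M M⊨T with decide (not-shattered k)
    ... | inj₁ T⊢ = to (⊨-not-shattered M k) (T⊢ M M⊨T)
    ... | inj₂ T⊢¬ = ⊥-elim (Level.lower (T⊢¬ M₀ M₀⊨T (from (⊨-not-shattered M₀ k) (FiniteVC⇒VC M₀ vc))))

  Selected : (M : Structure L) {w : ℕ} → Formula L (copies {L = L} w x ++ y) → Vec (M ^ x) w → M ^ y → Set ℓ
  Selected M γ es b = M ⊨ γ [ ++⁺ (block es) b ]

  -- For suitable parameters from the domain, the instance of γ has a solution, unique as far as φ on the
  -- domain is concerned, that agrees with p on a given sample.
  Selects : (N : Structure L) (k w : ℕ) → Formula L (copies {L = L} w x ++ y) → Set ℓ
  Selects N k w γ = ∀ {n} (dom : Fin n → N ^ x) {i₀ i₁} → dom i₀ ≢ dom i₁ → (p : Fin n → Bool) →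
    (∀ (e : Vec (Fin n) (sampleSize k)) → ∃ λ b → Allᵛ (λ i → R N b (dom i) ≡ p i) e) →
    ∀ (e : Vec (Fin n) (sampleSize k)) → Σ (Vec (Fin n) w) λ es → Σ (N ^ y) λ b →
      Selected N γ (Vec.map dom es) b ×
      (∀ b′ → Selected N γ (Vec.map dom es) b′ → ∀ i → R N b′ (dom i) ≡ R N b (dom i)) ×
      Allᵛ (λ i → R N b (dom i) ≡ p i) e

  -- The finite structure N satisfies one chosen sentence and need not be a model of T; `fact` is
  -- the consequence of T that selection in N relies on, and becomes a conjunct of `obstruction`.
  record Selector (T : Theory L) (k : ℕ) : Set (lsuc ℓ) where
    field
      arity   : ℕ
      γ       : Formula L (copies {L = L} arity x ++ y)
      fact    : Sentence L
      T⊢fact  : T ⊢ fact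
      selects : ∀ N → N ⊨ fact → VC N k → Selects N k arity γ

  module TreeFormula (w : ℕ) (γ : Formula L (copies {L = L} w x ++ y)) where
    open Trees w

    -- Where all solutions of γ have the same φ-values on the domain, the existential quantifier
    -- just evaluates φ(a,b) at any one of them, for a in the domain.
    Test : (M : Structure L) → M ^ x → Vec (M ^ x) w → Set ℓ
    Test M a es = Σ (M ^ y) λ b → Selected M γ es b × M ⊨ φ [ ++⁺ a b ]

    testᶠ : ∀ {Γ} → Sel Γ x → Vec (Sel Γ x) w → Formula L Γ
    testᶠ ξ es = ∃* y ((γ at block (Vec.map (weaken y) es) , bound y) ∧ᶠ (φ at weaken y ξ , bound y))

    treeᶠ : ∀ {Γ} t → Sel Γ x → Vec (Sel Γ x) (treeSize t) → Formula L Γ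
    treeᶠ zero    ξ (u ∷ u′ ∷ []) = (u ≈* u′) ⇒ᶠ ⊥ᶠ
    treeᶠ (suc t) ξ es = (testᶠ ξ (test t es) ∧ᶠ treeᶠ t ξ (branch t true es)) ∨ᶠ
                         ((testᶠ ξ (test t es) ⇒ᶠ ⊥ᶠ) ∧ᶠ treeᶠ t ξ (branch t false es))

    ψ : ∀ t → Formula L (x ++ copies {L = L} (treeSize t) x)
    ψ t = treeᶠ t (bound x) (unblock (treeSize t) (free x))

    module _ (M : Structure L) where
      open Semantics (Test M)

      ⊨-test : ∀ {Γ} (v : M ^ Γ) (ξ : Sel Γ x) (es : Vec (Sel Γ x) w) →
               M ⊨ testᶠ ξ es [ v ] ⇔ Test M (act v ξ) (Vec.map (act v) es)
      ⊨-test v ξ es = ⊨-∃* M y _ v ⇔-∙ ⇔-Σ λ b →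
        ⊨-at M γ (++⁺ b v) _ (bound y)
          (trans (map-block _ (Vec.map (weaken y) es))
            (cong block (trans (sym (Vec.map-∘ _ _ es)) (Vec.map-cong (act-weaken b v) es))))
          (act-bound b v)
        ⇔-× ⊨-at M φ (++⁺ b v) (weaken y ξ) (bound y) (act-weaken b v ξ) (act-bound b v)

      ⊨-tree : ∀ {Γ} t (v : M ^ Γ) (ξ : Sel Γ x) (es : Vec (Sel Γ x) (treeSize t)) →
               M ⊨ treeᶠ t ξ es [ v ] ⇔ Tree t (act v ξ) (Vec.map (act v) es)
      ⊨-tree zero    v ξ (u ∷ u′ ∷ []) = ⊨-≈* M v u u′ ⇔-→ ⇔-refl
      ⊨-tree (suc t) v ξ es = (tests ⇔-× branches true) ⇔-⊎ ((tests ⇔-→ ⇔-refl) ⇔-× branches false)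
        where
        tests : M ⊨ testᶠ ξ (test t es) [ v ] ⇔ Test M (act v ξ) (test t (Vec.map (act v) es))
        tests = ⊨-test v ξ (test t es) ⇔-∙ ⇔-≡ (cong (Test M (act v ξ)) (map-test (act v) t es))
        branches : ∀ s → M ⊨ treeᶠ t ξ (branch t s es) [ v ] ⇔ Tree t (act v ξ) (branch t s (Vec.map (act v) es))
        branches s = ⊨-tree t v ξ (branch t s es) ⇔-∙ ⇔-≡ (cong (Tree t (act v ξ)) (map-branch (act v) t s es))

      ⊨-ψ : ∀ t (a : M ^ x) (e : M ^ copies (treeSize t) x) → M ⊨ ψ t [ ++⁺ a e ] ⇔ Tree t a (unblock (treeSize t) e)
      ⊨-ψ t a e = ⊨-tree t (++⁺ a e) (bound x) (unblock (treeSize t) (free x)) ⇔-∙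
        ⇔-≡ (cong₂ (Tree t) (act-bound a e)
              (trans (map-unblock _ (treeSize t) (free x)) (cong (unblock (treeSize t)) (act-free a e))))

-- Transfer to finite structures

module Transfer (em : ∀ {a} → ExcludedMiddle a) {ℓ : Level} {L : Language ℓ} (x y : Ctx L) (φ : Formula L (x ++ y)) where
  open Classical em
  open Boosting em
  open Definability em x y φ
  open Structure

  truth-≡ : {P : Set a} {Q : Set b} → truth P ≡ truth Q ⇔ (P ⇔ Q)
  truth-≡ = mk⇔ (λ eq → mk⇔ (λ p → truth⁻ (trans (sym eq) (truth⁺ p))) (λ q → truth⁻ (trans eq (truth⁺ q)))) truth-cong

  enumerate : {A : Set a} {D : Pred A b} → Finite D →
    ∃ λ n → Σ (Fin n → A) λ f → (∀ i → D (f i)) × (∀ {z} → D z → ∃ λ i → f i ≡ z)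
  enumerate {A = A} {D = D} (xs , complete) = length zs , proj₁ ∘ List.lookup zs , proj₂ ∘ List.lookup zs ,
    λ p → let i = select⁺ xs (complete p) p in Any.index i , sym (lookup-index i)
    where
    select : List A → List (Σ A D)
    select []       = []
    select (z ∷ zs) with em {P = D z}
    ... | yes p = (z , p) ∷ select zs
    ... | no _  = select zs
    zs = select xs
    select⁺ : ∀ xs {z} → z ∈ xs → D z → Any.Any (λ q → z ≡ proj₁ q) (select xs)
    select⁺ (z ∷ zs) z∈ p with em {P = D z} | z∈
    ... | yes _ | here refl = here refl
    ... | yes _ | there z∈′ = there (select⁺ zs z∈′ p)
    ... | no ¬p | here refl = ⊥-elim (¬p p)
    ... | no _  | there z∈′ = select⁺ zs z∈′ p

  module _ {T : Theory L} {k : ℕ} (selector : Selector T k) where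
    open Selector selector
    open TreeFormula arity γ
    open Trees arity

    depth size : ℕ
    depth = hypothesisCount k
    size  = treeSize depth

    Ψ : Formula L (x ++ copies {L = L} size x)
    Ψ = ψ depth

    L′ : Language ℓ
    L′ = LanguagePQ L x

    private
      Params : Ctx L′
      Params = copies {L = L} size x
      Sample : Ctx L′
      Sample = copies {L = L} (sampleSize k) x

    Dom : (N : Structure L′) → Pred (N ^ x) ℓ
    Dom N z = ⟦ N ⟧ʳ P z ⊎ ⟦ N ⟧ʳ Q z

    Domᶠ : ∀ {Γ} → Sel Γ x → Formula L′ Γ
    Domᶠ ξ = atom P ξ ∨ᶠ atom Q ξ

    nontrivialᶠ : Sentence L′
    nontrivialᶠ = ∃* x (∃* x (Domᶠ (weaken x (bound x)) ∧ᶠ (Domᶠ (bound x) ∧ᶠ ((weaken x (bound x) ≈* bound x) ⇒ᶠ ⊥ᶠ))))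

    -- That all of p is realised is not expressible; its restriction to samples of a fixed size suffices.
    consistentᶠ : Sentence L′
    consistentᶠ = ∀* Sample (conjᵛ {L = L′} (unblock (sampleSize k) (bound Sample)) Domᶠ ⇒ᶠ
      ∃* y (conjᵛ {L = L′} (unblock (sampleSize k) (bound Sample)) λ ξ →
        oldᶠ (φ at weaken y ξ , bound y) ⇔ᶠ atom Q (weaken y ξ)))

    definableᶠ : Sentence L′
    definableᶠ = ∃* Params (conjᵛ {L = L′} (unblock size (bound Params)) Domᶠ ∧ᶠ
      ∀* x (Domᶠ (bound x) ⇒ᶠ (atom Q (bound x) ⇔ᶠ oldᶠ (Ψ at bound x , weaken x (bound Params)))))

    -- The sentence to which pseudofiniteness is applied: it would hold in the expansion of M if p
    -- were not definable, and `finite⇒definable` refutes it wherever P and Q are finite.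
    obstruction : Sentence L′
    obstruction = oldᶠ fact ∧ᶠ (oldᶠ (not-shattered k) ∧ᶠ (nontrivialᶠ ∧ᶠ (consistentᶠ ∧ᶠ (definableᶠ ⇒ᶠ ⊥ᶠ))))

    module _ (N : Structure L′) where

      private
        N₀ = reduct N

      LocallyConsistent : Set ℓ
      LocallyConsistent = ∀ (as : Vec (N ^ x) (sampleSize k)) → Allᵛ (Dom N) as →
        Σ (N ^ y) λ b → Allᵛ (λ a → R N₀ b a ≡ truth (⟦ N ⟧ʳ Q a)) as

      Definable : Set ℓ
      Definable = Σ (Vec (N ^ x) size) λ e → Allᵛ (Dom N) e ×
        (∀ a → Dom N a → ⟦ N ⟧ʳ Q a ⇔ N₀ ⊨ Ψ [ ++⁺ a (block e) ])

      ⊨-Dom : ∀ {Γ} (v : N ^ Γ) (ξ : Sel Γ x) → N ⊨ Domᶠ ξ [ v ] ⇔ Dom N (act v ξ)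
      ⊨-Dom v ξ = ⊨-atom N P v ξ ⇔-⊎ ⊨-atom N Q v ξ

      ⊨-unblock-Dom : ∀ {Γ} n (v : N ^ Γ) (ρ : Sel Γ (copies {L = L} n x)) {w} → act v ρ ≡ w →
        N ⊨ conjᵛ {L = L′} (unblock n ρ) Domᶠ [ v ] ⇔ Allᵛ (Dom N) (unblock n w)
      ⊨-unblock-Dom n v ρ refl = ⊨-conjᵛ N v (unblock n ρ) Domᶠ (⊨-Dom v) ⇔-∙
        ⇔-≡ (cong (Allᵛ (Dom N)) (map-unblock _ n ρ))

      ⊨-nontrivial : N ⊨ nontrivialᶠ ⇔ Nontrivial (Dom N)
      ⊨-nontrivial = ⊨-∃* N x _ [] ⇔-∙ ⇔-Σ λ a → ⊨-∃* N x _ (++⁺ a []) ⇔-∙ ⇔-Σ λ b →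
        let v = ++⁺ b (++⁺ a [])
            first  = trans (act-weaken b (++⁺ a []) (bound x)) (act-bound a [])
            second = act-bound b (++⁺ a [])
        in (⊨-Dom v (weaken x (bound x)) ⇔-∙ ⇔-≡ (cong (Dom N) first)) ⇔-×
           ((⊨-Dom v (bound x) ⇔-∙ ⇔-≡ (cong (Dom N) second)) ⇔-×
           ((⊨-≈* N v (weaken x (bound x)) (bound x) ⇔-∙ ⇔-≡ (cong₂ _≡_ first second)) ⇔-→
             mk⇔ Level.lower lift))

      ⊨-consistent : N ⊨ consistentᶠ ⇔ LocallyConsistent
      ⊨-consistent = ⊨-∀* N Sample _ [] ⇔-∙
        (⇔-Π λ w → ⊨-unblock-Dom m (++⁺ w []) (bound Sample) (act-bound w []) ⇔-→
          (⊨-∃* N y _ (++⁺ w []) ⇔-∙ ⇔-Σ λ b →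
            ⊨-conjᵛ N (++⁺ b (++⁺ w [])) (unblock m (bound Sample)) _ {g = act (++⁺ w [])} (literal w b) ⇔-∙
            ⇔-≡ (cong (Allᵛ _) (trans (map-unblock _ m (bound Sample)) (cong (unblock m) (act-bound w [])))))) ⇔-∙
        mk⇔ (λ h as → subst (λ as → Allᵛ (Dom N) as → Σ (N ^ y) λ b → Allᵛ (λ a → R N₀ b a ≡ truth (⟦ N ⟧ʳ Q a)) as)
                            (unblock-block as) (h (block as)))
            (λ h w → h (unblock m w))
        where
        m = sampleSize k
        literal : ∀ w b (ξ : Sel (Sample ++ []) x) →
          N ⊨ oldᶠ (φ at weaken y ξ , bound y) ⇔ᶠ atom Q (weaken y ξ) [ ++⁺ b (++⁺ w []) ] ⇔
          (R N₀ b (act (++⁺ w []) ξ) ≡ truth (⟦ N ⟧ʳ Q (act (++⁺ w []) ξ)))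
        literal w b ξ =
          ⇔-⇔ φ-part Q-part ⇔-∙ ⇔-sym truth-≡
          where
          v = ++⁺ b (++⁺ w [])
          φ-part = ⊨-old N (φ at weaken y ξ , bound y) v ⇔-∙
                   ⊨-at N₀ φ v (weaken y ξ) (bound y) (act-weaken b (++⁺ w []) ξ) (act-bound b (++⁺ w []))
          Q-part = ⊨-atom N Q v (weaken y ξ) ⇔-∙ ⇔-≡ (cong (⟦ N ⟧ʳ Q) (act-weaken b (++⁺ w []) ξ))

      ⊨-definable : N ⊨ definableᶠ ⇔ Definable
      ⊨-definable = ⊨-∃* N Params _ [] ⇔-∙
        (⇔-Σ λ w → ⊨-unblock-Dom size (++⁺ w []) (bound Params) (act-bound w []) ⇔-×
          (⊨-∀* N x _ (++⁺ w []) ⇔-∙ ⇔-Π λ a →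
            let v = ++⁺ a (++⁺ w [])
                Q-part = ⊨-atom N Q v (bound x) ⇔-∙ ⇔-≡ (cong (⟦ N ⟧ʳ Q) (act-bound a (++⁺ w [])))
                Ψ-part = ⊨-old N (Ψ at bound x , weaken x (bound Params)) v ⇔-∙
                         ⊨-at N₀ Ψ v (bound x) (weaken x (bound Params)) (act-bound a (++⁺ w []))
                           (trans (act-weaken a (++⁺ w []) (bound Params)) (act-bound w []))
            in (⊨-Dom v (bound x) ⇔-∙ ⇔-≡ (cong (Dom N) (act-bound a (++⁺ w [])))) ⇔-→
               ⇔-⇔ Q-part Ψ-part)) ⇔-∙
        mk⇔ (λ (w , in-D , h) → unblock size w , in-D ,
               subst (λ w → ∀ a → Dom N a → ⟦ N ⟧ʳ Q a ⇔ N₀ ⊨ Ψ [ ++⁺ a w ]) (sym (block-unblock size w)) h)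
            (λ (e , in-D , h) → block e , subst (Allᵛ (Dom N)) (sym (unblock-block e)) in-D , h)

      module Decode (holds : N₀ ⊨ fact) (vc : VC N₀ k) (consistent : LocallyConsistent)
        {n : ℕ} (dom : Fin n → N ^ x) (in-D : ∀ i → Dom N (dom i)) {i₀ i₁ : Fin n} (dom-≢ : dom i₀ ≢ dom i₁) where

        p : Fin n → Bool
        p i = truth (⟦ N ⟧ʳ Q (dom i))

        R′ : N ^ y → Fin n → Bool
        R′ b i = R N₀ b (dom i)

        vc′ : ∀ v → ¬ Shattered R′ v
        vc′ v sh = vc (Vec.map dom v) λ S → let b , eq = sh S in b , trans (sym (Vec.map-∘ (R N₀ b) dom v)) eq

        record Hypothesis : Set ℓ where
          field
            params   : Vec (Fin n) arity
            value    : N ^ y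
            selected : Selected N₀ γ (Vec.map dom params) value
            unique   : ∀ b → Selected N₀ γ (Vec.map dom params) b → ∀ i → R′ b i ≡ R′ value i
          parameters : Vec (N ^ x) arity
          parameters = Vec.map dom params

        open Hypothesis

        fit : ∀ (e : Vec (Fin n) (sampleSize k)) → Σ Hypothesis λ h → Allᵛ (λ i → R′ (value h) i ≡ p i) e
        fit e =
          let es , b , selected , unique , agrees = selects N₀ holds vc dom dom-≢ p
                (λ e → let b , agree = consistent (Vec.map dom e) (Allᵛ.map⁺ (Allᵛ.universal in-D e))
                       in b , Allᵛ.map⁻ agree) e
          in record { params = es ; value = b ; selected = selected ; unique = unique } , agrees

        test-value : ∀ i (h : Hypothesis) → R′ (value h) i ≡ truth (Test N₀ (dom i) (parameters h))
        test-value i h = truth-cong (mk⇔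
          (λ φab → value h , selected h , φab)
          (λ (b , selected′ , φab) → truth⁻ (trans (sym (unique h b selected′ i)) (truth⁺ φab))))

        decoded : Σ (Vec (Vec (N ^ x) arity) depth) λ hs → Allᵛ (Allᵛ (Dom N)) hs ×
          ∃ λ F → ∀ i → p i ≡ F (Vec.map (λ es → truth (Test N₀ (dom i) es)) hs)
        decoded =
          let hs , F , correct = decoder i₀ R′ p k vc′ value fit in
          Vec.map parameters hs ,
          Allᵛ.map⁺ (Allᵛ.universal (λ h → Allᵛ.map⁺ (Allᵛ.universal in-D (params h))) hs) ,
          F , λ i → trans (correct i) (cong F (trans (Vec.map-cong (test-value i) hs) (Vec.map-∘ _ parameters hs)))

        tests : Vec (Vec (N ^ x) arity) depth
        tests = proj₁ decoded

        answer : Vec Bool depth → Bool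
        answer = proj₁ (proj₂ (proj₂ decoded))

        code : Vec (N ^ x) size
        code = encode (dom i₀) (dom i₁) depth tests answer

        code-in-D : Allᵛ (Dom N) code
        code-in-D = All-encode (dom i₀) (dom i₁) (in-D i₀) (in-D i₁) depth answer (proj₁ (proj₂ decoded))

        code-defines : ∀ i → ⟦ N ⟧ʳ Q (dom i) ⇔ N₀ ⊨ Ψ [ ++⁺ (dom i) (block code) ]
        code-defines i =
          mk⇔ truth⁺ truth⁻ ⇔-∙
          ⇔-≡ (cong (_≡ true) (proj₂ (proj₂ (proj₂ decoded)) i)) ⇔-∙
          ⇔-sym (Tree-encode em dom-≢ depth (dom i) tests answer) ⇔-∙
          ⇔-≡ (cong (Tree depth (dom i)) (sym (unblock-block code))) ⇔-∙
          ⇔-sym (⊨-ψ N₀ depth (dom i) (block code))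
          where open Semantics (Test N₀)

      finite⇒definable : N₀ ⊨ fact → VC N₀ k → Nontrivial (Dom N) → LocallyConsistent →
                         Finite (⟦ N ⟧ʳ P) → Finite (⟦ N ⟧ʳ Q) → Definable
      finite⇒definable holds vc (d₀ , d₁ , d₀∈ , d₁∈ , d₀≢d₁) consistent (Ps , inPs) (Qs , inQs) =
        let n , dom , in-D , onto = enumerate {D = Dom N}
              (Ps List.++ Qs , λ { (inj₁ p) → ∈-++⁺ˡ (inPs p) ; (inj₂ q) → ∈-++⁺ʳ Ps (inQs q) })
            open module Code = Decode holds vc consistent dom in-D
              (λ eq → d₀≢d₁ (trans (sym (proj₂ (onto d₀∈))) (trans eq (proj₂ (onto d₁∈)))))
        in Code.code , Code.code-in-D , λ a a∈ → let i , eq = onto a∈ in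
             subst (λ a → ⟦ N ⟧ʳ Q a ⇔ N₀ ⊨ Ψ [ ++⁺ a (block Code.code) ]) eq (Code.code-defines i)

    module _ (M : Structure L) {D : Pred (M ^ x) ℓ} {p : SignedSet M x} (isType : IsType M x y φ D p) where
      open IsType isType

      private
        M′ = expand M (p false) (p true)

      open ElementaryExtension (proj₁ consistent)

      witness : target ^ y
      witness = proj₁ (proj₂ consistent)

      value : ∀ ε {a} → p ε a → R target witness (All.map embed a) ≡ ε
      value ε h = to (⊨-^ᶠ target φ _ ε) (proj₂ (proj₂ consistent) h)

      -- The realisation of p in the extension decides φ at a, and the literal it satisfies can be
      -- added to p consistently; by maximality it already belongs to p.
      covers : ∀ {a} → D a → Dom M′ a
      covers {a} a∈D = choose (R target witness (All.map embed a)) refl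
        where
        with-literal : Bool → SignedSet M x
        with-literal ε ε′ a′ = p ε′ a′ ⊎ (Lift ℓ (ε′ ≡ ε) × a′ ≡ a)
        added : ∀ ε → R target witness (All.map embed a) ≡ ε → p ε a
        added ε holds = maximal (with-literal ε)
          (λ { (inj₁ h) → over h ; (inj₂ (_ , refl)) → a∈D })
          (proj₁ consistent , witness , λ { (inj₁ h) → proj₂ (proj₂ consistent) h
                                          ; (inj₂ (lift refl , refl)) → from (⊨-^ᶠ target φ _ ε) holds })
          inj₁ (inj₂ (lift refl , refl))
        choose : ∀ ε → R target witness (All.map embed a) ≡ ε → Dom M′ a
        choose true  holds = inj₂ (added true holds)
        choose false holds = inj₁ (added false holds)

      agrees : ∀ {a} → Dom M′ a → R target witness (All.map embed a) ≡ truth (p true a)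
      agrees (inj₂ h) = trans (value true h) (sym (truth⁺ h))
      agrees (inj₁ h) = trans (value false h) (sym (truth-false⁺ λ h′ →
        case trans (sym (value false h)) (value true h′) of λ ()))

      -- p is realised only in an elementary extension, but a pattern on a fixed number of points is
      -- realised there by the truth of one formula with parameters in M, which descends to M.
      locally-consistent : LocallyConsistent M′
      locally-consistent as in-D =
        let S = Vec.map (λ a → truth (p true a)) as
            in-target : target ⊨ realises S [ All.map embed (block as) ]
            in-target = from (⊨-realises target S _) (witness ,
              trans (cong (Vec.map (R target witness)) (trans (sym (map-unblock embed (sampleSize k) (block as)))
                                                              (cong (Vec.map (All.map embed)) (unblock-block as))))
              (trans (sym (Vec.map-∘ _ _ as)) (map-cong⁺ _ _ (Allᵛ.map agrees in-D))))
            b , eq = to (⊨-realises M S (block as)) (from (elementary (realises S) (block as)) in-target)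
        in b , map-cong⁻ _ _ as (trans (cong (Vec.map (R M b)) (sym (unblock-block as))) eq)

    defines : (∀ M → M ⊨ᵀ T → VC M k) → DefinesPseudofiniteTypes T x y φ size Ψ
    defines vc M M⊨T D (d₀ , d₁ , d₀∈ , d₁∈ , d₀≢d₁) p isType pseudofinite = result
      where
      M′ = expand M (p false) (p true)
      definable : Definable M′
      -- Definability with parameters in D is itself a sentence of the expansion, so its failure in
      -- M would pass to some finite N.
      definable = decidable-stable em λ ¬definable →
        let N , (holds , vcN , nontrivial , locally , ¬def) , finP , finQ = pseudofinite obstruction
              ( from (⊨-old M′ fact []) (T⊢fact M M⊨T)
              , from (⊨-old M′ (not-shattered k) []) (from (⊨-not-shattered M k) (vc M M⊨T))
              , from (⊨-nontrivial M′) (d₀ , d₁ , covers M isType d₀∈ , covers M isType d₁∈ , d₀≢d₁)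
              , from (⊨-consistent M′) (locally-consistent M isType)
              , λ h → lift (¬definable (to (⊨-definable M′) h)) )
        in Level.lower (¬def (from (⊨-definable N) (finite⇒definable N
             (to (⊨-old N fact []) holds)
             (to (⊨-not-shattered (reduct N) k) (to (⊨-old N (not-shattered k) []) vcN))
             (to (⊨-nontrivial N) nontrivial) (to (⊨-consistent N) locally) finP finQ)))
      result : Σ (Vec (M ^ x) size) λ e → Allᵛ D e × (∀ a → D a → p true a ⇔ M ⊨ Ψ [ ++⁺ a (tuple M e) ])
      result = let e , in-D , correct = definable in
        e , Allᵛ.map [ IsType.over isType , IsType.over isType ]′ in-D ,
        λ a a∈ → correct a (covers M isType a∈) ⇔-∙ ⊨-cong M Ψ (cong (++⁺ a) (sym (tuple≡block M e)))

-- A labelled tuple of length r is written as a tuple of length r * 3: each entry is followed by two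
-- parameters, which differ when the label is true.
encodeLabels : A → A → ∀ {r} → Vec (A × Bool) r → Vec A (r * 3)
encodeLabels a₀ a₁ []            = []
encodeLabels a₀ a₁ ((a , s) ∷ γ) = a ∷ a₀ ∷ (if s then a₁ else a₀) ∷ encodeLabels a₀ a₁ γ

map-encodeLabels : (f : A → B) → ∀ {a₀ a₁ r} (γ : Vec (A × Bool) r) →
  Vec.map f (encodeLabels a₀ a₁ γ) ≡ encodeLabels (f a₀) (f a₁) (Vec.map (λ (a , s) → f a , s) γ)
map-encodeLabels f []                = refl
map-encodeLabels f ((a , true)  ∷ γ) = cong (λ es → f a ∷ _ ∷ _ ∷ es) (map-encodeLabels f γ)
map-encodeLabels f ((a , false) ∷ γ) = cong (λ es → f a ∷ _ ∷ _ ∷ es) (map-encodeLabels f γ)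

-- Selecting a hypothesis: by teaching sets, or by Skolem functions

module Selectors (em : ∀ {a} → ExcludedMiddle a) {ℓ : Level} {L : Language ℓ} (x y : Ctx L) (φ : Formula L (x ++ y)) where
  open Classical em
  open Boosting em
  open TeachingSets em
  open Definability em x y φ
  open Structure

  agreesᶠ : ∀ {Γ} r → Vec (Sel Γ x) (r * 3) → Sel Γ y → Formula L Γ
  agreesᶠ zero    []                υ = ⊤ᶠ
  agreesᶠ (suc r) (z ∷ u ∷ u′ ∷ zs) υ = ((φ at z , υ) ⇔ᶠ ((u ≈* u′) ⇒ᶠ ⊥ᶠ)) ∧ᶠ agreesᶠ r zs υ

  agreement : ∀ r → Formula L (copies {L = L} (r * 3) x ++ y)
  agreement r = agreesᶠ r (unblock (r * 3) (bound (copies {L = L} (r * 3) x))) (free (copies {L = L} (r * 3) x))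

  module _ (M : Structure L) where

    Agreesᵛ : ∀ {r} → M ^ y → Vec (M ^ x × Bool) r → Set ℓ
    Agreesᵛ b = Allᵛ (λ (a , s) → R M b a ≡ s)

    Coded : ∀ r → Vec (M ^ x) (r * 3) → M ^ y → Set ℓ
    Coded zero    []                b = Lift ℓ ⊥ → Lift ℓ ⊥
    Coded (suc r) (z ∷ u ∷ u′ ∷ zs) b =
      ((M ⊨ φ [ ++⁺ z b ] → (u ≡ u′ → Lift ℓ ⊥)) × ((u ≡ u′ → Lift ℓ ⊥) → M ⊨ φ [ ++⁺ z b ])) × Coded r zs b

    ⊨-agrees : ∀ {Γ} r (v : M ^ Γ) (zs : Vec (Sel Γ x) (r * 3)) (υ : Sel Γ y) →
               M ⊨ agreesᶠ r zs υ [ v ] ⇔ Coded r (Vec.map (act v) zs) (act v υ)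
    ⊨-agrees zero    v []                υ = ⇔-refl
    ⊨-agrees (suc r) v (z ∷ u ∷ u′ ∷ zs) υ =
      ((lit ⇔-→ code) ⇔-× (code ⇔-→ lit)) ⇔-× ⊨-agrees r v zs υ
      where
      lit  = ⊨-at M φ v z υ refl refl
      code = ⊨-≈* M v u u′ ⇔-→ ⇔-refl

    Coded-encode : ∀ {a₀ a₁} → a₀ ≢ a₁ → ∀ {r} (γ : Vec (M ^ x × Bool) r) b →
                   Coded r (encodeLabels a₀ a₁ γ) b ⇔ Agreesᵛ b γ
    Coded-encode a₀≢a₁ []            b = mk⇔ (λ _ → []) (λ _ → id)
    Coded-encode a₀≢a₁ ((a , true) ∷ γ) b =
      (mk⇔ (λ (_ , g) → truth⁺ (g λ eq → lift (a₀≢a₁ eq))) (λ eq → (λ _ eq → lift (a₀≢a₁ eq)) , λ _ → truth⁻ eq)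
        ⇔-× Coded-encode a₀≢a₁ γ b) ⇔-∙ mk⇔ (λ (e , es) → e ∷ es) (λ { (e ∷ es) → e , es })
    Coded-encode a₀≢a₁ ((a , false) ∷ γ) b =
      (mk⇔ (λ (f , _) → truth-false⁺ λ h → Level.lower (f h refl))
           (λ eq → (λ h → ⊥-elim (truth-false⁻ eq h)) , λ ne → ⊥-elim (Level.lower (ne refl)))
        ⇔-× Coded-encode a₀≢a₁ γ b) ⇔-∙ mk⇔ (λ (e , es) → e ∷ es) (λ { (e ∷ es) → e , es })

    ⊨-agreement : ∀ r (es : Vec (M ^ x) (r * 3)) b → Selected M (agreement r) es b ⇔ Coded r es b
    ⊨-agreement r es b = ⊨-agrees r (++⁺ (block es) b) _ _ ⇔-∙
      ⇔-≡ (cong₂ (Coded r) (trans (map-unblock _ (r * 3) (bound (copies (r * 3) x)))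
                               (trans (cong (unblock (r * 3)) (act-bound (block es) b)) (unblock-block es)))
                           (act-free (block es) b))

    selected-encode : ∀ {n} (dom : Fin n → M ^ x) {i₀ i₁} → dom i₀ ≢ dom i₁ → ∀ {r} (γ : Vec (Fin n × Bool) r) b →
      Selected M (agreement r) (Vec.map dom (encodeLabels i₀ i₁ γ)) b ⇔ Allᵛ (λ (i , s) → R M b (dom i) ≡ s) γ
    selected-encode dom {i₀} {i₁} ne {r} γ b =
      ⊨-agreement r _ b ⇔-∙
      ⇔-≡ (cong (λ es → Coded r es b) (map-encodeLabels dom γ)) ⇔-∙
      Coded-encode ne _ b ⇔-∙ mk⇔ Allᵛ.map⁻ Allᵛ.map⁺

  -- The lesson is taken within the class of those b that fit p on the sample, so sample and lesson
  -- together admit some b and fix its values on the domain. The lesson's labels follow this b and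
  -- may differ from p.
  agreement-selector : ∀ {T} k → Selector T k
  agreement-selector k = record
    { arity = r * 3
    ; γ = agreement r
    ; fact = ⊤ᶠ
    ; T⊢fact = λ _ _ → id
    ; selects = selects
    }
    where
    r = sampleSize k + teachingSize k
    selects : ∀ N → N ⊨ ⊤ᶠ {L = L} → VC N k → Selects N k (r * 3) (agreement r)
    selects N _ vc {n} dom {i₀} {i₁} ne p consistent e =
      encodeLabels i₀ i₁ γ , b₀ , from (selected-encode N dom ne γ b₀) agrees-γ ,
      (λ b′ selected → unique-γ b′ (to (selected-encode N dom ne γ b′) selected)) , proj₂ fitting
      where
      Fitting = Σ (N ^ y) λ b → Allᵛ (λ i → R N b (dom i) ≡ p i) e
      R′ : Fitting → Fin n → Bool
      R′ (b , _) i = R N b (dom i)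
      taught = teaching-set k R′
        (λ v sh → vc (Vec.map dom v) λ S → let (b , _) , eq = sh S in b , trans (sym (Vec.map-∘ (R N b) dom v)) eq)
        (consistent e)
      lesson = proj₁ taught
      fitting = proj₁ (proj₂ (proj₂ taught))
      b₀ = proj₁ fitting
      sample = label e (Vec.map p e)
      γ : Vec (Fin n × Bool) r
      -- The padding repeats a label that `b₀` really has, since any other would exclude it.
      γ = pad r (i₀ , R N b₀ (dom i₀)) (sample List.++ lesson)
      agrees-γ : Allᵛ (λ (i , s) → R N b₀ (dom i) ≡ s) γ
      agrees-γ = pad⁺ r _ (sample List.++ lesson) refl
        (All.++⁺ (label⁺ (R′ fitting) e (map-cong⁺ _ _ (proj₂ fitting))) (proj₁ (proj₂ (proj₂ (proj₂ taught)))))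
      short : length (sample List.++ lesson) ≤ r
      short = ≤-trans (≤-reflexive (length-++ sample)) (+-mono-≤ (≤-reflexive (length-label e _)) (proj₁ (proj₂ taught)))
      unique-γ : ∀ b′ → Allᵛ (λ (i , s) → R N b′ (dom i) ≡ s) γ → ∀ i → R N b′ (dom i) ≡ R N b₀ (dom i)
      unique-γ b′ agrees =
        let both = pad⁻ r _ (sample List.++ lesson) short agrees
            fits = map-cong⁻ _ p e (label⁻ (λ i → R N b′ (dom i)) e (Vec.map p e) (All.++⁻ˡ sample both))
        in proj₂ (proj₂ (proj₂ (proj₂ taught))) (b′ , fits) (All.++⁻ʳ sample both)

  module Skolem {T : Theory L} (skolem : HasSkolemFunctions T) (k : ℕ) where

    private
      r = sampleSize k
      Δ : Ctx L
      Δ = copies {L = L} (r * 3) x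

    function : DefinableFunction T Δ y
    function = proj₁ (skolem Δ y (agreement r))

    open DefinableFunction function

    -- Functionality of the graph and the Skolem property are stated for all parameters in one
    -- sentence, since they have to be available in N.
    skolem-fact : Sentence L
    skolem-fact = ∀* Δ (
      ∃* y ((graph at weaken y (bound Δ) , bound y) ∧ᶠ
            (∃* y (agreement r at weaken y (weaken y (bound Δ)) , bound y) ⇒ᶠ (agreement r at weaken y (bound Δ) , bound y))) ∧ᶠ
      ∀* y (∀* y ((graph at weaken y (weaken y (bound Δ)) , weaken y (bound y)) ⇒ᶠ
                  ((graph at weaken y (weaken y (bound Δ)) , bound y) ⇒ᶠ (weaken y (bound y) ≈* bound y)))))

    SkolemFact : Structure L → Set ℓ
    SkolemFact M = ∀ (u : M ^ Δ) →
      (Σ (M ^ y) λ b → M ⊨ graph [ ++⁺ u b ] × ((Σ (M ^ y) λ b′ → M ⊨ agreement r [ ++⁺ u b′ ]) → M ⊨ agreement r [ ++⁺ u b ])) ×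
      (∀ b b′ → M ⊨ graph [ ++⁺ u b ] → M ⊨ graph [ ++⁺ u b′ ] → b ≡ b′)

    ⊨-skolem-fact : ∀ M → M ⊨ skolem-fact ⇔ SkolemFact M
    ⊨-skolem-fact M = ⊨-∀* M Δ _ [] ⇔-∙ ⇔-Π λ u →
      let v = ++⁺ u [] in
      (⊨-∃* M y _ v ⇔-∙ ⇔-Σ λ b →
        ⊨-at M graph (++⁺ b v) _ _ (once u b) (act-bound b v) ⇔-×
        ((⊨-∃* M y _ (++⁺ b v) ⇔-∙ ⇔-Σ λ b′ →
          ⊨-at M (agreement r) (++⁺ b′ (++⁺ b v)) _ _ (twice u b b′) (act-bound b′ (++⁺ b v)))
         ⇔-→ ⊨-at M (agreement r) (++⁺ b v) _ _ (once u b) (act-bound b v))) ⇔-×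
      (⊨-∀* M y _ v ⇔-∙ ⇔-Π λ b → ⊨-∀* M y _ (++⁺ b v) ⇔-∙ ⇔-Π λ b′ →
        let v′ = ++⁺ b′ (++⁺ b v)
            first  = trans (act-weaken b′ (++⁺ b v) (bound y)) (act-bound b v)
            second = act-bound b′ (++⁺ b v)
        in ⊨-at M graph v′ _ _ (twice u b b′) first ⇔-→
           (⊨-at M graph v′ _ _ (twice u b b′) second ⇔-→
            (⊨-≈* M v′ (weaken y (bound y)) (bound y) ⇔-∙ ⇔-≡ (cong₂ _≡_ first second))))
      where
      once : ∀ (u : M ^ Δ) (b : M ^ y) → act (++⁺ b (++⁺ u [])) (weaken y (bound Δ)) ≡ u
      once u b = trans (act-weaken b (++⁺ u []) (bound Δ)) (act-bound u [])
      twice : ∀ (u : M ^ Δ) (b b′ : M ^ y) → act (++⁺ b′ (++⁺ b (++⁺ u []))) (weaken y (weaken y (bound Δ))) ≡ u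
      twice u b b′ = trans (act-weaken b′ (++⁺ b (++⁺ u [])) (weaken y (bound Δ))) (once u b)

    T⊢skolem-fact : T ⊢ skolem-fact
    T⊢skolem-fact M M⊨T = from (⊨-skolem-fact M) λ u →
      let b , holds , unique = functional M M⊨T u
      in (b , holds , proj₂ (skolem Δ y (agreement r)) M M⊨T u) ,
         λ b₁ b₂ g₁ g₂ → trans (sym (unique g₁)) (unique g₂)

    -- The graph determines b outright, so the labelled sample alone serves as parameters; the
    -- Skolem property makes b fit it because some element does.
    skolem-selector : Selector T k
    skolem-selector = record
      { arity = r * 3
      ; γ = graph
      ; fact = skolem-fact
      ; T⊢fact = T⊢skolem-fact
      ; selects = λ N holds vc dom {i₀} {i₁} ne p consistent e →
          let labelled = Vec.map (λ i → i , p i) e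
              es = encodeLabels i₀ i₁ labelled
              b′ , agree = consistent e
              (b , selected , agrees) , unique = to (⊨-skolem-fact N) holds (block (Vec.map dom es))
              coded = agrees (b′ , from (selected-encode N dom ne labelled b′) (Allᵛ.map⁺ agree))
          in es , b , selected , (λ b″ selected″ i → cong (λ β → R N β (dom i)) (unique b″ b selected″ selected)) ,
             Allᵛ.map⁻ (to (selected-encode N dom ne labelled b) coded)
      }

-- NIP for decision trees whose tests are instances of φ

ite : Bool → Bool × Bool → Bool
ite h (s , s′) = if h then s else s′

map-ite : (h s s′ : A → Bool) {m : ℕ} (v : Vec A m) →
  Vec.map (λ a → ite (h a) (s a , s′ a)) v ≡ Vec.zipWith ite (Vec.map h v) (Vec.zip (Vec.map s v) (Vec.map s′ v))
map-ite h s s′ []      = refl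
map-ite h s s′ (a ∷ v) = cong (ite (h a) (s a , s′ a) ∷_) (map-ite h s s′ v)

module TreeNIP (em : ∀ {a} → ExcludedMiddle a) {ℓ : Level} {L : Language ℓ} (x y : Ctx L) (φ : Formula L (x ++ y))
  (w : ℕ) (γ : Formula L (copies {L = L} w x ++ y)) (M : Structure L) where
  open Classical em
  open Combinatorics em
  open Definability em x y φ
  open TreeFormula w γ
  open Trees w
  open Semantics (Test M)

  treeTrace : ∀ t → Vec (M ^ x) (treeSize t) → M ^ x → Bool
  treeTrace t es a = truth (Tree t a es)

  module _ {k : ℕ} (vc : VC M k)
    (functional : ∀ (es : Vec (M ^ x) w) →
      Σ (M ^ y) λ b → Selected M {w} γ es b × (∀ b′ → Selected M {w} γ es b′ → b ≡ b′)) where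

    -- The root test is an instance of φ, whence the factor `Φ k m`; the two subtrees have their own
    -- parameters, whence the square. A leaf does not depend on a, so its trace is constant.
    traceBound : ℕ → ℕ → ℕ
    traceBound zero    m = 2
    traceBound (suc t) m = Φ k m * (traceBound t m * traceBound t m)

    tree-cover : ∀ t {m} (v : Vec (M ^ x) m) → Cover (traceBound t m) (Trace (treeTrace t) v)
    tree-cover zero {m} v = Vec.replicate m true ∷ Vec.replicate m false ∷ [] , ≤-refl ,
      λ { (u ∷ u′ ∷ [] , refl) → subst (_∈ _) (sym (Vec.map-const v _))
            (constant (truth (u ≡ u′ → Lift ℓ ⊥))) }
      where
      constant : ∀ s → Vec.replicate m s ∈ Vec.replicate m true ∷ Vec.replicate m false ∷ []
      constant true  = here refl
      constant false = there (here refl)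
    tree-cover (suc t) v =
      let L₁ , ≤₁ , ⊆₁ = traces-cover k vc v
          L₂ , ≤₂ , ⊆₂ = tree-cover t v
          pairs = cartesianProductWith Vec.zip L₂ L₂
      in cartesianProductWith (Vec.zipWith ite) L₁ pairs ,
         ≤-trans (≤-reflexive (trans (length-cartesianProductWith (Vec.zipWith ite) L₁ pairs)
                                     (cong (length L₁ *_) (length-cartesianProductWith Vec.zip L₂ L₂))))
                 (*-mono-≤ ≤₁ (*-mono-≤ ≤₂ ≤₂)) ,
         λ { (es , refl) →
           let b = proj₁ (functional (test t es)) in
           subst (_∈ cartesianProductWith (Vec.zipWith ite) L₁ pairs)
             (sym (trans (Vec.map-cong (step es) v) (map-ite (R M b) _ _ v)))
             (∈-cartesianProductWith⁺ (Vec.zipWith ite) (⊆₁ (b , refl))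
               (∈-cartesianProductWith⁺ Vec.zip (⊆₂ (branch t true es , refl)) (⊆₂ (branch t false es , refl)))) }
      where
      step : ∀ es a → treeTrace (suc t) es a ≡
        ite (R M (proj₁ (functional (test t es))) a) (treeTrace t (branch t true es) a , treeTrace t (branch t false es) a)
      step es a =
        let b , selected , unique = functional (test t es)
            test-value : truth (Test M a (test t es)) ≡ R M b a
            test-value = truth-cong (mk⇔
              (λ (b′ , selected′ , h) → subst (λ b → M ⊨ φ [ ++⁺ a b ]) (sym (unique b′ selected′)) h)
              (λ h → b , selected , h))
        in trans (truth-cong (Tree-if em t a es)) (trans
             (cong (λ s → treeTrace t (branch t s es) a) test-value) (choose (R M b a)))
        where
        choose : ∀ s → treeTrace t (branch t s es) a ≡ ite s (treeTrace t (branch t true es) a , treeTrace t (branch t false es) a)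
        choose true  = refl
        choose false = refl

    coefficient degree : ℕ → ℕ
    coefficient zero    = 1
    coefficient (suc t) = coefficient t + coefficient t
    degree zero    = 0
    degree (suc t) = k + (degree t + degree t)

    traceBound-polynomial : ∀ t m → traceBound t m ≤ 2 ^ℕ coefficient t * suc m ^ℕ degree t
    traceBound-polynomial zero    m = ≤-refl
    traceBound-polynomial (suc t) m = begin
      Φ k m * (traceBound t m * traceBound t m)   ≤⟨ *-mono-≤ (Φ≤ k m) (*-mono-≤ (traceBound-polynomial t m) (traceBound-polynomial t m)) ⟩
      n ^ℕ k * (E * N * (E * N))                  ≡⟨ lemma (n ^ℕ k) E N ⟩
      E * E * (n ^ℕ k * (N * N))                  ≡⟨ cong₂ _*_ (^-distribˡ-+-* 2 e e) (trans (^-distribˡ-+-* n k (q + q)) (cong (n ^ℕ k *_) (^-distribˡ-+-* n q q))) ⟨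
      2 ^ℕ (e + e) * n ^ℕ (k + (q + q))           ∎
      where
      open ≤-Reasoning
      n = suc m
      e = coefficient t
      q = degree t
      E = 2 ^ℕ e
      N = n ^ℕ q
      lemma : ∀ p E N → p * (E * N * (E * N)) ≡ E * E * (p * (N * N))
      lemma = solve-∀

    -- For fixed t the number of traces on m points is polynomial in m, and so falls below 2 ^ m for
    -- some m.
    tree-unshattered : ∀ t → ∃ λ m → ∀ (v : Vec (M ^ x) m) → ¬ Shattered (treeTrace t) v
    tree-unshattered t = m , λ v sh → <-irrefl refl (begin-strict
      2 ^ℕ m                                             ≡⟨ length-vecs _ m ⟨
      length (patterns m)                                ≡⟨ ∑-1 (patterns m) ⟨
      ∑ (patterns m) (λ _ → 1)                           ≤⟨ ∑-mono (patterns m) (λ S → ind⁺ (sh S)) ⟩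
      ∑ (patterns m) (λ S → ind (Trace (treeTrace t) v S)) ≤⟨ count≤cover (tree-cover t v) ⟩
      traceBound t m                                     ≤⟨ traceBound-polynomial t m ⟩
      2 ^ℕ coefficient t * suc m ^ℕ degree t             ≡⟨ trans (cong (2 ^ℕ coefficient t * suc m ^ℕ degree t *_) (^-zeroˡ m)) (*-identityʳ _) ⟨
      2 ^ℕ coefficient t * suc m ^ℕ degree t * 1 ^ℕ m    <⟨ proj₂ growth ⟩
      2 ^ℕ m                                             ∎)
      where
      open ≤-Reasoning
      growth = polynomial<exponential (2 ^ℕ coefficient t) (degree t) 0
      m = proj₁ growth

    tree-FiniteVC : ∀ t → FiniteVC (λ (e : M ^ copies (treeSize t) x) (a : M ^ x) → M ⊨ ψ t [ ++⁺ a e ])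
    tree-FiniteVC t = m , λ a _ shatters → ≮⇒≥ λ m<n → contradict a shatters (m≤n⇒∃[o]m+o≡n (<⇒≤ m<n))
      where
      m = proj₁ (tree-unshattered t)
      contradict : ∀ {n} (a : Fin n → M ^ x) → Shatters (λ (e : M ^ copies (treeSize t) x) a → M ⊨ ψ t [ ++⁺ a e ]) a →
                   (∃ λ o → m + o ≡ n) → ⊥
      contradict a shatters (o , refl) = proj₂ (tree-unshattered t) (Vec.tabulate (λ i → a (i ↑ˡ o))) λ S →
        -- Only the first m of the n points matter; the pattern is extended arbitrarily to the
        -- others.
        let S′ = S Vec.++ Vec.replicate o false
            e , traced = shatters S′
        in unblock (treeSize t) e ,
           trans (sym (Vec.tabulate-∘ _ _)) (trans (Vec.tabulate-cong λ i → value S′ e traced (i ↑ˡ o) (Vec.lookup-++ˡ S _ i))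
                                                   (Vec.tabulate∘lookup S))
        where
        value : ∀ S′ e → (∀ j → M ⊨ ψ t [ ++⁺ (a j) e ] ⇔ S′ Vec.[ j ]= true) → ∀ j {s} → Vec.lookup S′ j ≡ s →
                treeTrace t (unblock (treeSize t) e) (a j) ≡ s
        value S′ e traced j {s} eq = trans (truth-cong (⇔-sym (⊨-ψ M t (a j) e) ⇔-∙ traced j ⇔-∙
          mk⇔ (λ j∈ → trans (sym eq) (Vec.[]=⇒lookup j∈)) (λ s≡ → Vec.lookup⇒[]= j S′ (trans eq s≡)))) (truth-true s)
          where
          truth-true : ∀ s → truth (s ≡ true) ≡ s
          truth-true true  = truth⁺ refl
          truth-true false = truth-false⁺ λ ()

theorem5p36 : (∀ {a : Level} → ExcludedMiddle a) →
    ∀ {ℓ : Level} (L : Language ℓ) (T : Theory L) → Complete T →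
    ∀ (x y : Ctx L) (φ : Formula L (x ++ y)) → NIP T x y φ →
    (∃ λ n → ∃ λ ψ → DefinesPseudofiniteTypes T x y φ n ψ) ×
    (HasSkolemFunctions T →
    ∃ λ n → ∃ λ ψ → DefinesPseudofiniteTypes T x y φ n ψ × NIP T x (copies n x) ψ)
theorem5p36 em L T complete x y φ nip@(M₀ , M₀⊨T , finiteVC) =
  (size selector , Ψ selector , defines selector vc) ,
  λ skolem → let open Skolem skolem k in
    size skolem-selector , Ψ skolem-selector , defines skolem-selector vc , M₀ , M₀⊨T ,
    -- The Skolem function is total on the model, so every parameter tuple, in D or not, gives a
    -- test that is an instance of φ.
    TreeNIP.tree-FiniteVC em x y φ _ (DefinableFunction.graph function) M₀ (vc M₀ M₀⊨T)
      (λ es → let b , holds , unique = DefinableFunction.functional function M₀ M₀⊨T (block es)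
              in b , holds , λ _ → unique)
      (hypothesisCount k)
  where
  open Boosting em
  open Definability em x y φ
  open Transfer em x y φ
  open Selectors em x y φ
  k = proj₁ (NIP⇒VC complete nip)
  vc = proj₂ (NIP⇒VC complete nip)
  selector : Selector T k
  selector = agreement-selector k
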